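{- Let $t\ge 10$ be an integer and let $n$ be an integer with $n\ge 200t^2\ln t + 400t^2$. Then every coloring of the edges of the complete $3$-uniform hypergraph on $n$ vertices with two colors contains a monochromatic copy of the hedgehog $H_t$. That is, $$r(H_t) < 200t^2\ln t + 400t^2+1.$$
   Context: The hedgehog $H_t$ is the $3$-uniform hypergraph on $t+\binom{t}{2}$ vertices $1,\dots,t+\binom t2$ such that for each pair $1\le i<j\le t$ there is a unique vertex $k=k(i,j)>t$ such that $\{i,j,k\}$ is an edge (distinct pairs having distinct vertices $k$), and there are no other edges. A monochromatic copy of $H_t$ in a $2$-colored complete $3$-uniform hypergraph is an injective map of the vertices of $H_t$ into the vertex set such that the images of all edges of $H_t$ receive the same color. The Ramsey number $r(H_t)$ is the smallest $n$ such that every $2$-coloring of the edges (all $3$-element subsets) of the complete $3$-uniform hypergraph on $n$ vertices contains a monochromatic copy of $H_t$. -}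

module Defs where

open import Data.Empty using (⊥-elim)
open import Data.Fin as Fin using (Fin; zero; suc; toℕ)
import Data.Fin.Properties as Finₚ
open import Data.Fin.Subset using (Subset; ⁅_⁆; _∪_; ∣_∣)
import Data.Fin.Subset.Properties as Subsetₚ
open import Data.Bool using (true; false)
import Data.Integer as ℤ
import Data.Integer.Properties as ℤₚ
import Data.Integer.Tactic.RingSolver as ℤSolver
open import Data.Nat as ℕ using (ℕ; zero; suc; z≤n; s≤s)
open import Data.Nat.Combinatorics using (_C_; nC1≡n; nCk+nC[k+1]≡[n+1]C[k+1])
import Data.Nat.Properties as ℕₚ
open import Data.Nat.Tactic.RingSolver using (solve-∀)
open import Data.Product using (Σ; Σ-syntax; ∃-syntax; _×_; _,_; proj₁; proj₂)
open import Data.Rational as ℚ using (ℚ; 0ℚ; mkℚ)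
import Data.Rational.Properties as ℚₚ
import Data.Rational.Solver as ℚSolver
open import Data.Rational.Unnormalised as ℚᵘ using (mkℚᵘ)
import Data.Rational.Unnormalised.Properties as ℚᵘₚ
open import Data.Sum using (_⊎_; inj₁; inj₂; [_,_]′)
open import Data.Vec using (_∷_)
open import Function.Base using (_∘_)
open import Function.Bundles using (_↔_; mk↔ₛ′)
open import Function.Construct.Composition using (_↔-∘_)
open import Function.Construct.Symmetry using (↔-sym)
open import Function.Construct.Identity using (↔-id)
open import Function.Definitions using (Injective)
open import Data.Sum.Function.Propositional using (_⊎-↔_)
open import Relation.Binary.PropositionalEquality
  using (_≡_; _≢_; refl; sym; trans; cong; cong₂; subst)
open import Relation.Nullary using (¬_)

------------------------------------------------------------------------
-- Real numbers

IsCauchy : (ℕ → ℚ) → Set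
IsCauchy x = ∀ ε → 0ℚ ℚ.< ε →
  ∃[ N ] (∀ m n → N ℕ.≤ m → N ℕ.≤ n → ℚ.∣ x m ℚ.- x n ∣ ℚ.≤ ε)

-- Two reals are regarded as equal when each is ≤ the other (_≤_ below).
record ℝ : Set where
  constructor mkℝ
  field
    seq    : ℕ → ℚ
    cauchy : IsCauchy seq
open ℝ public

infix 4 _≤_ _<_

_≤_ : ℝ → ℝ → Set
x ≤ y = ∀ ε → 0ℚ ℚ.< ε → ∃[ N ] (∀ n → N ℕ.≤ n → seq x n ℚ.≤ seq y n ℚ.+ ε)

-- The classical strict order.  The constructively stronger "bounded apart by a
-- positive rational" is equivalent to it only with Markov's principle.
_<_ : ℝ → ℝ → Set
x < y = ¬ (y ≤ x)

fromℚ : ℚ → ℝ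
fromℚ q = mkℝ (λ _ → q) λ ε 0<ε → 0 , λ _ _ _ _ →
  subst (ℚ._≤ ε) (sym (cong ℚ.∣_∣ (ℚₚ.+-inverseʳ q))) (ℚₚ.<⇒≤ 0<ε)

fromℕ : ℕ → ℝ
fromℕ n = fromℚ (ℤ.+ n ℚ./ 1)

private
  half-pos : ∀ ε → 0ℚ ℚ.< ε → 0ℚ ℚ.< ℚ.½ ℚ.* ε
  half-pos ε 0<ε = ℚₚ.*-monoʳ-<-pos ℚ.½ 0<ε

  halves : ∀ ε → ℚ.½ ℚ.* ε ℚ.+ ℚ.½ ℚ.* ε ≡ ε
  halves ε = trans (sym (ℚₚ.*-distribʳ-+ ε ℚ.½ ℚ.½)) (ℚₚ.*-identityˡ ε)

infixl 6 _+_

_+_ : ℝ → ℝ → ℝ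
x + y = mkℝ (λ n → seq x n ℚ.+ seq y n) λ ε 0<ε →
  let (M , p) = cauchy x (ℚ.½ ℚ.* ε) (half-pos ε 0<ε)
      (N , q) = cauchy y (ℚ.½ ℚ.* ε) (half-pos ε 0<ε)
  in M ℕ.⊔ N , λ m n m≥ n≥ → begin
    ℚ.∣ (seq x m ℚ.+ seq y m) ℚ.- (seq x n ℚ.+ seq y n) ∣
      ≡⟨ cong ℚ.∣_∣ (rearrange (seq x m) (seq y m) (seq x n) (seq y n)) ⟩
    ℚ.∣ (seq x m ℚ.- seq x n) ℚ.+ (seq y m ℚ.- seq y n) ∣
      ≤⟨ ℚₚ.∣p+q∣≤∣p∣+∣q∣ (seq x m ℚ.- seq x n) (seq y m ℚ.- seq y n) ⟩
    ℚ.∣ seq x m ℚ.- seq x n ∣ ℚ.+ ℚ.∣ seq y m ℚ.- seq y n ∣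
      ≤⟨ ℚₚ.+-mono-≤ (p m n (ℕₚ.m⊔n≤o⇒m≤o M N m≥) (ℕₚ.m⊔n≤o⇒m≤o M N n≥))
                     (q m n (ℕₚ.m⊔n≤o⇒n≤o M N m≥) (ℕₚ.m⊔n≤o⇒n≤o M N n≥)) ⟩
    ℚ.½ ℚ.* ε ℚ.+ ℚ.½ ℚ.* ε
      ≡⟨ halves ε ⟩
    ε ∎
  where
  open ℚₚ.≤-Reasoning
  rearrange : ∀ a b c d → (a ℚ.+ b) ℚ.- (c ℚ.+ d) ≡ (a ℚ.- c) ℚ.+ (b ℚ.- d)
  rearrange = solve 4 (λ a b c d → (a :+ b) :- (c :+ d) := (a :- c) :+ (b :- d)) refl
    where open ℚSolver.+-*-Solver

-- The natural multiple x + ⋯ + x (c summands).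
infixr 7 _·_

_·_ : ℕ → ℝ → ℝ
zero  · x = fromℕ 0
suc c · x = x + c · x

------------------------------------------------------------------------
-- The natural logarithm of a positive integer

∑< : ℕ → (ℕ → ℚ) → ℚ
∑< zero    f = 0ℚ
∑< (suc n) f = ∑< n f ℚ.+ f n

syntax ∑< n (λ i → e) = ∑[ i < n ] e

1/1+_ : ℕ → ℚ
1/1+ n = ℤ.+ 1 ℚ./ suc n

-- ln t = ∫₁ᵗ dx/x.  Cutting [1 , t] into N (t ∸ 1) intervals of length 1/N, the
-- right Riemann sum is
--   Σ_{i < N (t ∸ 1)} (1/N) · 1 / (1 + (i+1)/N) = Σ_{i < N (t ∸ 1)} 1 / (1 + N + i).
riemann : (t N : ℕ) → ℚ
riemann t N = ∑[ i < N ℕ.* (t ℕ.∸ 1) ] (1/1+ (N ℕ.+ i))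

module RiemannSums where
  open ℚₚ.≤-Reasoning

  frac : ℕ → ℕ → ℚ
  frac m b = ℚ.fromℚᵘ (mkℚᵘ (ℤ.+ m) b)

  frac-suc : ∀ m b → frac m b ℚ.+ (1/1+ b) ≡ frac (suc m) b
  frac-suc m b = ℚₚ.toℚᵘ-injective (ℚᵘₚ.≃-trans
    (ℚₚ.toℚᵘ-homo-+ (frac m b) (1/1+ b))
    (ℚᵘₚ.≃-trans
      (ℚᵘₚ.+-cong (ℚₚ.toℚᵘ-fromℚᵘ (mkℚᵘ (ℤ.+ m) b)) (ℚₚ.toℚᵘ-fromℚᵘ (mkℚᵘ (ℤ.+ 1) b)))
      (ℚᵘₚ.≃-trans (ℚᵘ.*≡* (arith (ℤ.+ m) (ℤ.+ suc b)))
        (ℚᵘₚ.≃-sym (ℚₚ.toℚᵘ-fromℚᵘ (mkℚᵘ (ℤ.+ suc m) b))))))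
    where
    arith : ∀ m d → (m ℤ.* d ℤ.+ ℤ.1ℤ ℤ.* d) ℤ.* d ≡ (ℤ.1ℤ ℤ.+ m) ℤ.* (d ℤ.* d)
    arith = ℤSolver.solve-∀

  ∑-const : ∀ m b → ∑[ i < m ] (1/1+ b) ≡ frac m b
  ∑-const zero b = ℚₚ.fromℚᵘ-cong {mkℚᵘ (ℤ.+ 0) 0} {mkℚᵘ (ℤ.+ 0) b} (ℚᵘ.*≡* refl)
  ∑-const (suc m) b = trans (cong (ℚ._+ (1/1+ b)) (∑-const m b)) (frac-suc m b)

  frac-cancel : ∀ m a b → suc b ≡ suc a ℕ.* m → frac m b ≡ 1/1+ a
  frac-cancel m a b eq = ℚₚ.fromℚᵘ-cong {mkℚᵘ (ℤ.+ m) b} {mkℚᵘ (ℤ.+ 1) a}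
    (ℚᵘ.*≡* (trans (sym (ℤₚ.pos-* m (suc a))) (trans (cong ℤ.+_
      (trans (ℕₚ.*-comm m (suc a)) (trans (sym eq) (sym (ℕₚ.*-identityˡ (suc b))))))
      (ℤₚ.pos-* 1 (suc b)))))

  recip-anti : ∀ {m n} → m ℕ.≤ n → 1/1+ n ℚ.≤ 1/1+ m
  recip-anti {m} {n} m≤n = ℚₚ.toℚᵘ-cancel-≤
    (ℚᵘₚ.≤-respˡ-≃ (ℚᵘₚ.≃-sym (ℚₚ.toℚᵘ-fromℚᵘ (mkℚᵘ (ℤ.+ 1) n)))
    (ℚᵘₚ.≤-respʳ-≃ (ℚᵘₚ.≃-sym (ℚₚ.toℚᵘ-fromℚᵘ (mkℚᵘ (ℤ.+ 1) m)))
    (ℚᵘ.*≤* (ℤ.+≤+ (ℕₚ.*-monoʳ-≤ 1 (s≤s m≤n))))))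

  recip-nonneg : ∀ n → 0ℚ ℚ.≤ 1/1+ n
  recip-nonneg n = ℚₚ.toℚᵘ-cancel-≤
    (ℚᵘₚ.≤-respʳ-≃ (ℚᵘₚ.≃-sym (ℚₚ.toℚᵘ-fromℚᵘ (mkℚᵘ (ℤ.+ 1) n)))
    (ℚᵘ.*≤* (ℤ.+≤+ z≤n)))

  ∑-mono : ∀ n {f g : ℕ → ℚ} → (∀ i → i ℕ.< n → f i ℚ.≤ g i) → ∑< n f ℚ.≤ ∑< n g
  ∑-mono zero    h = ℚₚ.≤-refl
  ∑-mono (suc n) h =
    ℚₚ.+-mono-≤ (∑-mono n λ i i<n → h i (ℕₚ.m<n⇒m<1+n i<n)) (h n ℕₚ.≤-refl)

  ∑-cong : ∀ n {f g : ℕ → ℚ} → (∀ i → f i ≡ g i) → ∑< n f ≡ ∑< n g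
  ∑-cong zero    h = refl
  ∑-cong (suc n) h = cong₂ ℚ._+_ (∑-cong n h) (h n)

  ∑-split : ∀ m n f → ∑< (m ℕ.+ n) f ≡ ∑< m f ℚ.+ ∑[ i < n ] f (m ℕ.+ i)
  ∑-split m zero f =
    trans (cong (λ k → ∑< k f) (ℕₚ.+-identityʳ m)) (sym (ℚₚ.+-identityʳ _))
  ∑-split m (suc n) f = trans (cong (λ k → ∑< k f) (ℕₚ.+-suc m n))
    (trans (cong (ℚ._+ f (m ℕ.+ n)) (∑-split m n f)) (ℚₚ.+-assoc (∑< m f) _ _))

  ∑-blocks : ∀ a m f → ∑< (a ℕ.* m) f ≡ ∑[ j < a ] ∑[ l < m ] f (j ℕ.* m ℕ.+ l)
  ∑-blocks zero    m f = refl
  ∑-blocks (suc a) m f = trans (cong (λ k → ∑< k f) (ℕₚ.+-comm m (a ℕ.* m)))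
    (trans (∑-split (a ℕ.* m) m f) (cong (ℚ._+ ∑[ l < m ] f (a ℕ.* m ℕ.+ l)) (∑-blocks a m f)))

  ∑-shift : ∀ a k → ∑[ i < a ] (1/1+ (k ℕ.+ i)) ℚ.+ (1/1+ (k ℕ.+ a))
                  ≡ ∑[ i < a ] (1/1+ (suc k ℕ.+ i)) ℚ.+ (1/1+ k)
  ∑-shift zero k = cong (λ j → 0ℚ ℚ.+ (1/1+ j)) (ℕₚ.+-identityʳ k)
  ∑-shift (suc a) k = trans (cong (ℚ._+ (1/1+ (k ℕ.+ suc a))) (∑-shift a k))
    (trans (cong (λ j → ∑[ i < a ] (1/1+ (suc k ℕ.+ i)) ℚ.+ (1/1+ k) ℚ.+ (1/1+ j))
             (ℕₚ.+-suc k a))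
           (swap (∑[ i < a ] (1/1+ (suc k ℕ.+ i))) (1/1+ k) (1/1+ (suc k ℕ.+ a))))
    where
    open ℚSolver.+-*-Solver
    swap : ∀ x y z → x ℚ.+ y ℚ.+ z ≡ x ℚ.+ z ℚ.+ y
    swap = solve 3 (λ x y z → x :+ y :+ z := x :+ z :+ y) refl

  refined : ∀ s N m →
    ∑[ i < N ℕ.* m ℕ.* s ] (1/1+ (N ℕ.* m ℕ.+ i))
      ≡ ∑[ j < N ℕ.* s ] ∑[ l < m ] (1/1+ (N ℕ.* m ℕ.+ (j ℕ.* m ℕ.+ l)))
  refined s N m = trans
    (cong (λ k → ∑[ i < k ] (1/1+ (N ℕ.* m ℕ.+ i))) (swap N m s))
    (∑-blocks (N ℕ.* s) m _)
    where
    swap : ∀ N m s → N ℕ.* m ℕ.* s ≡ N ℕ.* s ℕ.* m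
    swap = solve-∀

  module _ (t N₁ m₁ : ℕ) where
    private
      N m s : ℕ
      N = suc N₁
      m = suc m₁
      s = t ℕ.∸ 1

    refine-≥ : riemann t N ℚ.≤ riemann t (N ℕ.* m)
    refine-≥ = ℚₚ.≤-trans (∑-mono (N ℕ.* s) λ j _ → block j)
      (ℚₚ.≤-reflexive (sym (refined s N m)))
      where
      bound : ∀ N j m₁ → m₁ ℕ.+ (N ℕ.+ j) ℕ.* suc m₁
                       ≡ N ℕ.* suc m₁ ℕ.+ (j ℕ.* suc m₁ ℕ.+ m₁)
      bound = solve-∀
      block : ∀ j → 1/1+ (N ℕ.+ j)
                      ℚ.≤ ∑[ l < m ] (1/1+ (N ℕ.* m ℕ.+ (j ℕ.* m ℕ.+ l)))
      block j = begin
        1/1+ (N ℕ.+ j)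
          ≡⟨ frac-cancel m (N ℕ.+ j) (m₁ ℕ.+ (N ℕ.+ j) ℕ.* m) refl ⟨
        frac m (m₁ ℕ.+ (N ℕ.+ j) ℕ.* m)
          ≡⟨ ∑-const m _ ⟨
        ∑[ l < m ] (1/1+ (m₁ ℕ.+ (N ℕ.+ j) ℕ.* m))
          ≤⟨ ∑-mono m (λ l l<m → recip-anti (ℕₚ.≤-trans
               (ℕₚ.+-monoʳ-≤ (N ℕ.* m) (ℕₚ.+-monoʳ-≤ (j ℕ.* m) (ℕₚ.≤-pred l<m)))
               (ℕₚ.≤-reflexive (sym (bound N j m₁))))) ⟩
        ∑[ l < m ] (1/1+ (N ℕ.* m ℕ.+ (j ℕ.* m ℕ.+ l))) ∎

    refine-≤ : riemann t (N ℕ.* m) ℚ.≤ riemann t N ℚ.+ (1/1+ N₁)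
    refine-≤ = begin
      riemann t (N ℕ.* m)
        ≡⟨ refined s N m ⟩
      ∑[ j < N ℕ.* s ] ∑[ l < m ] (1/1+ (N ℕ.* m ℕ.+ (j ℕ.* m ℕ.+ l)))
        ≤⟨ ∑-mono (N ℕ.* s) (λ j _ → block j) ⟩
      ∑[ j < N ℕ.* s ] (1/1+ (N₁ ℕ.+ j))
        ≡⟨ ℚₚ.+-identityʳ _ ⟨
      ∑[ j < N ℕ.* s ] (1/1+ (N₁ ℕ.+ j)) ℚ.+ 0ℚ
        ≤⟨ ℚₚ.+-monoʳ-≤ (∑[ j < N ℕ.* s ] (1/1+ (N₁ ℕ.+ j))) (recip-nonneg (N₁ ℕ.+ N ℕ.* s)) ⟩
      ∑[ j < N ℕ.* s ] (1/1+ (N₁ ℕ.+ j)) ℚ.+ (1/1+ (N₁ ℕ.+ N ℕ.* s))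
        ≡⟨ ∑-shift (N ℕ.* s) N₁ ⟩
      riemann t N ℚ.+ (1/1+ N₁) ∎
      where
      bound : ∀ N₁ j m₁ l → suc (m₁ ℕ.+ (N₁ ℕ.+ j) ℕ.* suc m₁ ℕ.+ l)
                          ≡ suc N₁ ℕ.* suc m₁ ℕ.+ (j ℕ.* suc m₁ ℕ.+ l)
      bound = solve-∀
      block : ∀ j → ∑[ l < m ] (1/1+ (N ℕ.* m ℕ.+ (j ℕ.* m ℕ.+ l)))
                      ℚ.≤ 1/1+ (N₁ ℕ.+ j)
      block j = begin
        ∑[ l < m ] (1/1+ (N ℕ.* m ℕ.+ (j ℕ.* m ℕ.+ l)))
          ≤⟨ ∑-mono m (λ l _ → recip-anti (ℕₚ.≤-trans (ℕₚ.m≤m+n _ l)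
               (ℕₚ.≤-trans (ℕₚ.n≤1+n _) (ℕₚ.≤-reflexive (bound N₁ j m₁ l))))) ⟩
        ∑[ l < m ] (1/1+ (m₁ ℕ.+ (N₁ ℕ.+ j) ℕ.* m))
          ≡⟨ ∑-const m _ ⟩
        frac m (m₁ ℕ.+ (N₁ ℕ.+ j) ℕ.* m)
          ≡⟨ frac-cancel m (N₁ ℕ.+ j) (m₁ ℕ.+ (N₁ ℕ.+ j) ℕ.* m) refl ⟩
        1/1+ (N₁ ℕ.+ j) ∎

  sub-≤ : ∀ {x y z} → x ℚ.≤ y ℚ.+ z → x ℚ.- y ℚ.≤ z
  sub-≤ {x} {y} {z} h = ℚₚ.≤-trans (ℚₚ.+-monoˡ-≤ (ℚ.- y) h) (ℚₚ.≤-reflexive (cancel y z))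
    where
    open ℚSolver.+-*-Solver
    cancel : ∀ y z → y ℚ.+ z ℚ.- y ≡ z
    cancel = solve 2 (λ y z → y :+ z :- y := z) refl

  abs-≤ : ∀ {x y z} → x ℚ.≤ y ℚ.+ z → y ℚ.≤ x ℚ.+ z → ℚ.∣ x ℚ.- y ∣ ℚ.≤ z
  abs-≤ {x} {y} {z} p q with ℚₚ.∣p∣≡p∨∣p∣≡-p (x ℚ.- y)
  ... | inj₁ e = ℚₚ.≤-trans (ℚₚ.≤-reflexive e) (sub-≤ p)
  ... | inj₂ e = ℚₚ.≤-trans (ℚₚ.≤-reflexive (trans e (neg x y))) (sub-≤ q)
    where
    open ℚSolver.+-*-Solver
    neg : ∀ x y → ℚ.- (x ℚ.- y) ≡ y ℚ.- x
    neg = solve 2 (λ x y → :- (x :- y) := y :- x) refl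

  riemann-≤ : ∀ t {K} k l → K ℕ.≤ l →
    riemann t (suc k) ℚ.≤ riemann t (suc l) ℚ.+ (1/1+ K)
  riemann-≤ t {K} k l K≤l = begin
    riemann t (suc k)
      ≤⟨ refine-≥ t k l ⟩
    riemann t (suc k ℕ.* suc l)
      ≡⟨ cong (riemann t) (ℕₚ.*-comm (suc k) (suc l)) ⟩
    riemann t (suc l ℕ.* suc k)
      ≤⟨ refine-≤ t l k ⟩
    riemann t (suc l) ℚ.+ (1/1+ l)
      ≤⟨ ℚₚ.+-monoʳ-≤ (riemann t (suc l)) (recip-anti K≤l) ⟩
    riemann t (suc l) ℚ.+ (1/1+ K) ∎

  archimedean : ∀ ε → 0ℚ ℚ.< ε → ∃[ K ] (1/1+ K ℚ.≤ ε)
  archimedean (mkℚ (ℤ.+ zero)  d _) (ℚ.*<* (ℤ.+<+ ()))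
  archimedean (mkℚ (ℤ.+ suc a) d _) _ = d , ℚₚ.toℚᵘ-cancel-≤
    (ℚᵘₚ.≤-respˡ-≃ (ℚᵘₚ.≃-sym (ℚₚ.toℚᵘ-fromℚᵘ (mkℚᵘ (ℤ.+ 1) d)))
    (ℚᵘ.*≤* (ℤ.+≤+ (ℕₚ.*-monoˡ-≤ (suc d) (s≤s (z≤n {a}))))))
  archimedean (mkℚ (ℤ.-[1+ _ ]) d _) (ℚ.*<* ())

riemann-cauchy : ∀ t → IsCauchy (λ k → riemann t (suc k))
riemann-cauchy t ε 0<ε with RiemannSums.archimedean ε 0<ε
... | K , 1/K≤ε = K , λ k l K≤k K≤l →
  ℚₚ.≤-trans (abs-≤ (riemann-≤ t k l K≤l) (riemann-≤ t l k K≤k)) 1/K≤ε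
  where open RiemannSums

-- Only meaningful for t ≥ 1.
ln : ℕ → ℝ
ln t = mkℝ (λ k → riemann t (suc k)) (riemann-cauchy t)

------------------------------------------------------------------------
-- Hedgehogs

Pair : ℕ → Set
Pair t = Σ[ i ∈ Fin t ] Σ[ j ∈ Fin t ] i Fin.< j

-- The vertices 1, …, t are inj₁ i, and the vertex k(i,j) > t is inj₂ (i , j , i<j).
Vertex : ℕ → Set
Vertex t = Fin t ⊎ Pair t

data Edge (t : ℕ) : Vertex t → Vertex t → Vertex t → Set where
  edge : ∀ {i j} (i<j : i Fin.< j) → Edge t (inj₁ i) (inj₁ j) (inj₂ (i , j , i<j))

pair-suc : ∀ t → Vertex t ↔ Pair (suc t)
pair-suc t = mk↔ₛ′ to from to-from from-to
  where
  to : Vertex t → Pair (suc t)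
  to (inj₁ j)             = zero , suc j , s≤s z≤n
  to (inj₂ (i , j , i<j)) = suc i , suc j , s≤s i<j
  from : Pair (suc t) → Vertex t
  from (zero  , suc j , _)   = inj₁ j
  from (suc i , suc j , i<j) = inj₂ (i , j , ℕₚ.≤-pred i<j)
  to-from : ∀ p → to (from p) ≡ p
  to-from (zero  , suc j , s≤s z≤n) = refl
  to-from (suc i , suc j , s≤s i<j) = refl
  from-to : ∀ v → from (to v) ≡ v
  from-to (inj₁ j)             = refl
  from-to (inj₂ (i , j , i<j)) = refl

[1+t]C2 : ∀ t → t ℕ.+ t C 2 ≡ suc t C 2
[1+t]C2 t = trans (cong (ℕ._+ t C 2) (sym (nC1≡n t))) (nCk+nC[k+1]≡[n+1]C[k+1] t 1)

pair-count : ∀ t → Fin (t C 2) ↔ Pair t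
pair-count zero    = mk↔ₛ′ (λ ()) (λ { (() , _) }) (λ { (() , _) }) (λ ())
pair-count (suc t) = subst (λ n → Fin n ↔ Pair (suc t)) ([1+t]C2 t)
  (pair-suc t ↔-∘ ((↔-id (Fin t) ⊎-↔ pair-count t) ↔-∘ Finₚ.+↔⊎))

vertex-count : ∀ t → Fin (t ℕ.+ t C 2) ↔ Vertex t
vertex-count t = (↔-id (Fin t) ⊎-↔ pair-count t) ↔-∘ Finₚ.+↔⊎

edge-distinct : ∀ {t u v w} → Edge t u v w → u ≢ v × u ≢ w × v ≢ w
edge-distinct (edge i<j) = (λ { refl → ℕₚ.<-irrefl refl i<j }) , (λ ()) , (λ ())

------------------------------------------------------------------------
-- Ramsey numbers of hedgehogs

-- An edge of the complete 3-uniform hypergraph on Fin n.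
Triple : ℕ → Set
Triple n = Σ[ e ∈ Subset n ] ∣ e ∣ ≡ 3

Colouring : ℕ → Set
Colouring n = Triple n → Fin 2

∣⁅x⁆∪p∣ : ∀ {n} (x : Fin n) (p : Subset n) → ¬ (x Data.Fin.Subset.∈ p) →
          ∣ ⁅ x ⁆ ∪ p ∣ ≡ suc ∣ p ∣
∣⁅x⁆∪p∣ zero    (true  ∷ p) x∉p = ⊥-elim (x∉p Data.Vec.here)
∣⁅x⁆∪p∣ zero    (false ∷ p) x∉p = cong (suc ∘ ∣_∣) (Subsetₚ.∪-identityˡ p)
∣⁅x⁆∪p∣ (suc x) (true  ∷ p) x∉p = cong suc (∣⁅x⁆∪p∣ x p (x∉p ∘ Data.Vec.there))
∣⁅x⁆∪p∣ (suc x) (false ∷ p) x∉p = ∣⁅x⁆∪p∣ x p (x∉p ∘ Data.Vec.there)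

triple : ∀ {n} (x y z : Fin n) → x ≢ y → x ≢ z → y ≢ z → Triple n
triple x y z x≢y x≢z y≢z = ⁅ x ⁆ ∪ (⁅ y ⁆ ∪ ⁅ z ⁆) ,
  trans (∣⁅x⁆∪p∣ x _ x∉yz)
    (cong suc (trans (∣⁅x⁆∪p∣ y _ (y≢z ∘ Subsetₚ.x∈⁅y⁆⇒x≡y z))
      (cong suc (Subsetₚ.∣⁅x⁆∣≡1 z))))
  where
  x∉yz : ¬ (x Data.Fin.Subset.∈ ⁅ y ⁆ ∪ ⁅ z ⁆)
  x∉yz = [ x≢y ∘ Subsetₚ.x∈⁅y⁆⇒x≡y y , x≢z ∘ Subsetₚ.x∈⁅y⁆⇒x≡y z ]′
       ∘ Subsetₚ.x∈p∪q⁻ ⁅ y ⁆ ⁅ z ⁆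

image : ∀ {t n} (f : Vertex t → Fin n) → Injective _≡_ _≡_ f →
        ∀ {u v w} → Edge t u v w → Triple n
image f inj {u} {v} {w} e =
  let (u≢v , u≢w , v≢w) = edge-distinct e
  in triple (f u) (f v) (f w) (u≢v ∘ inj) (u≢w ∘ inj) (v≢w ∘ inj)

record MonochromaticHedgehog (t : ℕ) {n : ℕ} (χ : Colouring n) : Set where
  field
    embed     : Vertex t → Fin n
    injective : Injective _≡_ _≡_ embed
    colour    : Fin 2
    mono      : ∀ {u v w} (e : Edge t u v w) → χ (image embed injective e) ≡ colour

Unavoidable : (t n : ℕ) → Set
Unavoidable t n = (χ : Colouring n) → MonochromaticHedgehog t χ

-- r(H_t) = r.
IsRamseyNumber : (t r : ℕ) → Set
IsRamseyNumber t r = Unavoidable t r × (∀ n → Unavoidable t n → r ℕ.≤ n)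

{-# OPTIONS --safe #-}

-- A body of each colour is grown simultaneously inside a shrinking set V of
-- eligible vertices.  Given u in V, take the least scale s = 4t·2^i ≤ 32t² such
-- that, for some colour c′, more than 2s vertices v of V have fewer than s hooks
-- for {u,v} in colour c′, and reserve 4t such v as the star of u.  Almost all
-- triples through u and its star have the colour c opposite to c′, so by double
-- counting all but 2s vertices w have at least 2t hooks in colour c for {u,w}
-- inside the star.  (If no such scale exists, the star is empty and every w counts
-- as remaining.)  On the remaining ("bad") w, minimality of s leaves at most 2r
-- vertices of degree below r at every scale r.  Hence, with a weight inversely
-- proportional to the degree, the bad pairs at u weigh O(1) per scale, and there
-- are log₂ t + O(1) scales.  As n ≥ 100t²(log₂ t + 4), always adding the cheapest
-- vertex of the more frequent colour keeps the total weight of a body so small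
-- that among any q of its bad pairs one has at least 9q hooks.  So the bad pairs
-- can be hooked greedily, using at most t vertices of each star, and each star
-- still serves the other pairs at its centre.

module Submission where

-- Counting in finite sets: union bounds, averaging and distinct representatives.

module Counting where

  open import Algebra.Properties.Semiring.Sum as Sum using ()
  open import Data.Bool.Base using (Bool; true; false; T)
  open import Data.Fin.Base using (Fin; zero; suc; _↑ˡ_; _↑ʳ_; combine)
  open import Data.Fin.Properties using (any?; _≟_)
  open import Data.Nat.Base
  open import Data.Nat.Properties hiding (_≟_)
  open import Data.Product.Base using (Σ-syntax; ∃-syntax; _×_; _,_; proj₁; proj₂)
  open import Data.Sum.Base using (_⊎_; inj₁; inj₂)
  open import Data.Vec.Functional using (_∷_)
  open import Function.Base using (_∘_; const)
  open import Function.Definitions using (Injective)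
  open import Relation.Binary.PropositionalEquality
  open import Relation.Nullary using (¬_; Dec; yes; no; contradiction; T?)
  open import Relation.Nullary.Decidable using (_×-dec_; ¬?; ⊤-dec)
  open import Relation.Unary using (Pred; Decidable)
  open import Level using (0ℓ)

  open Sum +-*-semiring public
    using (sum; ∑-distrib-+; ∑-comm; sum-cong-≗; sum-replicate-zero; *-distribˡ-sum; *-distribʳ-sum)

  private variable
    m n : ℕ
    P Q R : Pred (Fin n) 0ℓ

  indicator : ∀ {A : Set} → Dec A → ℕ
  indicator (yes _) = 1
  indicator (no _)  = 0

  indicator-mono : ∀ {A B : Set} (a? : Dec A) (b? : Dec B) → (A → B) → indicator a? ≤ indicator b?
  indicator-mono (yes a) (yes b) f = ≤-refl
  indicator-mono (yes a) (no ¬b) f = contradiction (f a) ¬b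
  indicator-mono (no ¬a) b?      f = z≤n

  indicator-yes : ∀ {A : Set} (a? : Dec A) → A → indicator a? ≡ 1
  indicator-yes (yes _) a = refl
  indicator-yes (no ¬a) a = contradiction a ¬a

  # : {P : Pred (Fin n) 0ℓ} → Decidable P → ℕ
  # P? = sum λ x → indicator (P? x)

  sum-mono : ∀ {f g : Fin n → ℕ} → (∀ x → f x ≤ g x) → sum f ≤ sum g
  sum-mono {zero}  f≤g = z≤n
  sum-mono {suc n} f≤g = +-mono-≤ (f≤g zero) (sum-mono (f≤g ∘ suc))

  term≤sum : ∀ (f : Fin n → ℕ) x → f x ≤ sum f
  term≤sum f zero    = m≤m+n _ _
  term≤sum f (suc x) = ≤-trans (term≤sum (f ∘ suc) x) (m≤n+m _ _)

  sum-replicate-≤ : ∀ n {f : Fin n → ℕ} c → (∀ x → f x ≤ c) → sum f ≤ n * c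
  sum-replicate-≤ zero    c f≤c = z≤n
  sum-replicate-≤ (suc n) c f≤c = +-mono-≤ (f≤c zero) (sum-replicate-≤ n c (f≤c ∘ suc))

  #-mono : (P? : Decidable P) (Q? : Decidable Q) → (∀ {x} → P x → Q x) → # P? ≤ # Q?
  #-mono P? Q? P⊆Q = sum-mono λ x → indicator-mono (P? x) (Q? x) P⊆Q

  #-⊎ : (P? : Decidable P) (Q? : Decidable Q) (R? : Decidable R) →
        (∀ {x} → P x → Q x ⊎ R x) → # P? ≤ # Q? + # R?
  #-⊎ P? Q? R? P⊆Q∪R = ≤-trans (sum-mono pointwise) (≤-reflexive (∑-distrib-+ (indicator ∘ Q?) (indicator ∘ R?)))
    where
    pointwise : ∀ x → indicator (P? x) ≤ indicator (Q? x) + indicator (R? x)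
    pointwise x with P? x
    ... | no _ = z≤n
    ... | yes p with P⊆Q∪R p
    ...   | inj₁ q = ≤-trans (≤-reflexive (sym (indicator-yes (Q? x) q))) (m≤m+n _ _)
    ...   | inj₂ r = ≤-trans (≤-reflexive (sym (indicator-yes (R? x) r))) (m≤n+m _ _)

  #-all : (P? : Decidable {A = Fin n} P) → (∀ x → P x) → # P? ≡ n
  #-all {zero}  P? all = refl
  #-all {suc n} P? all = cong₂ _+_ (indicator-yes (P? zero) (all zero)) (#-all (P? ∘ suc) (all ∘ suc))

  #-∅ : (P? : Decidable P) → (∀ x → ¬ P x) → # P? ≡ 0
  #-∅ {zero}  P? ¬P = refl
  #-∅ {suc n} P? ¬P with P? zero
  ... | yes p = contradiction p (¬P zero)
  ... | no _  = #-∅ (P? ∘ suc) (¬P ∘ suc)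

  #-unique : (P? : Decidable P) → (∀ {x y} → P x → P y → x ≡ y) → # P? ≤ 1
  #-unique {zero}  P? unique = z≤n
  #-unique {suc n} P? unique with P? zero
  ... | yes p = ≤-reflexive (cong suc (#-∅ (P? ∘ suc) λ x q → contradiction (unique p q) λ ()))
  ... | no _  = #-unique (P? ∘ suc) λ p q → suc-inj (unique p q)
    where
    suc-inj : ∀ {m} {x y : Fin m} → Fin.suc x ≡ suc y → x ≡ y
    suc-inj refl = refl

  #-positive : (P? : Decidable P) → ∀ {x} → P x → 0 < # P?
  #-positive P? {x} p = ≤-trans (≤-reflexive (sym (indicator-yes (P? x) p))) (term≤sum (indicator ∘ P?) x)

  #-strict : (P? : Decidable P) (Q? : Decidable Q) → (∀ {x} → P x → Q x) → ∀ {x} → Q x → ¬ P x → # P? < # Q?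
  #-strict P? Q? P⊆Q {x} q ¬p = begin-strict
    # P?                                              ≡⟨ +-identityʳ _ ⟨
    # P? + 0                                          <⟨ +-monoʳ-< (# P?) (#-positive (_≟ x) refl) ⟩
    # P? + # (_≟ x)                                   ≡⟨ ∑-distrib-+ (indicator ∘ P?) (λ y → indicator (y ≟ x)) ⟨
    (sum λ y → indicator (P? y) + indicator (y ≟ x))  ≤⟨ sum-mono pointwise ⟩
    # Q?                                              ∎
    where
    open ≤-Reasoning
    pointwise : ∀ y → indicator (P? y) + indicator (y ≟ x) ≤ indicator (Q? y)
    pointwise y with P? y | y ≟ x
    ... | yes p | yes refl = contradiction p ¬p
    ... | yes p | no _     = ≤-reflexive (sym (indicator-yes (Q? y) (P⊆Q p)))
    ... | no _  | yes refl = ≤-reflexive (sym (indicator-yes (Q? y) q))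
    ... | no _  | no _     = z≤n

  #<#⇒∃ : (P? : Decidable P) (Q? : Decidable Q) → # P? < # Q? → ∃[ x ] Q x × ¬ P x
  #<#⇒∃ {P = P} P? Q? P<Q with any? (λ x → Q? x ×-dec ¬? (P? x))
  ... | yes w = w
  ... | no ¬w = contradiction (#-mono Q? P? Q⊆P) (<⇒≱ P<Q)
    where
    Q⊆P : ∀ {x} → _ → P x
    Q⊆P {x} q with P? x
    ... | yes p = p
    ... | no ¬p = contradiction (x , q , ¬p) ¬w

  #-∃ : {R : Fin m → Pred (Fin n) 0ℓ} (∃? : Decidable λ y → ∃[ x ] R x y) (R? : ∀ x → Decidable (R x)) →
        # ∃? ≤ sum λ x → # (R? x)
  #-∃ {n = n} {R} ∃? R? = ≤-trans (sum-mono pointwise) (≤-reflexive (∑-comm λ y x → indicator (R? x y)))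
    where
    pointwise : ∀ y → indicator (∃? y) ≤ sum λ x → indicator (R? x y)
    pointwise y with ∃? y
    ... | no _        = z≤n
    ... | yes (x , r) = ≤-trans (≤-reflexive (sym (indicator-yes (R? x y) r))) (term≤sum (λ x → indicator (R? x y)) x)

  #-disjoint : {R : Fin m → Pred (Fin n) 0ℓ} (R? : ∀ x → Decidable (R x)) (Q? : Decidable Q) →
               (∀ {x y} → R x y → Q y) → (∀ {x x′ y} → R x y → R x′ y → x ≡ x′) →
               (sum λ x → # (R? x)) ≤ # Q?
  #-disjoint {m = m} {R = R} R? Q? R⊆Q disjoint =
    -- After the sums are exchanged, disjointness leaves at most one `x` for each `y`.
    ≤-trans (≤-reflexive (∑-comm λ x y → indicator (R? x y))) (sum-mono pointwise)
    where
    pointwise : ∀ y → (sum λ x → indicator (R? x y)) ≤ indicator (Q? y)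
    pointwise y with Q? y
    ... | yes _ = #-unique (λ x → R? x y) disjoint
    ... | no ¬q = ≤-reflexive (#-∅ (λ x → R? x y) λ x r → ¬q (R⊆Q r))

  #-image : {Q : Pred (Fin m) 0ℓ} (Q? : Decidable Q) (g : Fin m → Fin n)
            (image? : Decidable λ y → ∃[ x ] Q x × g x ≡ y) → # image? ≤ # Q?
  #-image Q? g image? = ≤-trans (#-∃ image? (λ x y → Q? x ×-dec g x ≟ y)) (sum-mono pointwise)
    where
    pointwise : ∀ x → # (λ y → Q? x ×-dec g x ≟ y) ≤ indicator (Q? x)
    pointwise x with Q? x
    ... | yes _ = #-unique (λ y → yes _ ×-dec g x ≟ y) λ p q → trans (sym (proj₂ p)) (proj₂ q)
    ... | no ¬q = ≤-reflexive (#-∅ (λ y → no ¬q ×-dec g x ≟ y) λ y p → ¬q (proj₁ p))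

  -- Cuts a star of exact size out of a larger set by taking its first `m` elements; the Boolean
  -- form keeps membership decidable.
  subset-of-size : (P? : Decidable P) → m ≤ # P? →
                   Σ[ B ∈ (Fin n → Bool) ] (∀ x → T (B x) → P x) × # (T? ∘ B) ≡ m
  subset-of-size {zero}  P? z≤n = (λ ()) , (λ ()) , refl
  subset-of-size {suc n} {P} {m} P? m≤#P with P? zero
  ... | no _ =
    let (B , B⊆P , #B) = subset-of-size (P? ∘ suc) m≤#P
    in false ∷ B , (λ { (suc x) → B⊆P x }) , #B
  subset-of-size {suc n} {P} {zero} P? _ | yes p = const false , (λ _ ()) , #-∅ {suc n} (λ _ → T? false) (λ _ ())
  subset-of-size {suc n} {P} {suc m} P? m≤#P | yes p =
    let (B , B⊆P , #B) = subset-of-size (P? ∘ suc) (≤-pred m≤#P)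
    in true ∷ B , (λ { zero _ → p ; (suc x) → B⊆P x }) , cong suc #B

  -- Otherwise `f x * # P?` is at least `A + 1` on all of `P`, and summing over the nonempty `P`
  -- gives `# P? * (A + 1) ≤ # P? * A`. The product form avoids division.
  below-average : (P? : Decidable P) (f : Fin n → ℕ) {A : ℕ} → 0 < # P? →
                  (sum λ x → indicator (P? x) * f x) ≤ A → ∃[ x ] P x × f x * # P? ≤ A
  below-average {P = P} P? f {A} 0<#P ∑≤A with any? (λ x → P? x ×-dec f x * # P? ≤? A)
  ... | yes w = w
  ... | no ¬w = contradiction A+1≤A (<⇒≱ (m<n+m (# P? * A) 0<#P))
    where
    open ≤-Reasoning
    pointwise : ∀ x → indicator (P? x) * suc A ≤ indicator (P? x) * f x * # P?
    pointwise x with P? x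
    ... | no _  = z≤n
    ... | yes p with f x * # P? ≤? A
    ...   | yes h = contradiction (x , p , h) ¬w
    ...   | no h  = begin
      1 * suc A          ≡⟨ *-identityˡ _ ⟩
      suc A              ≤⟨ ≰⇒> h ⟩
      f x * # P?         ≡⟨ cong (_* # P?) (sym (*-identityˡ (f x))) ⟩
      1 * f x * # P?     ∎
    A+1≤A : # P? + # P? * A ≤ # P? * A
    A+1≤A = begin
      # P? + # P? * A                              ≡⟨ *-suc (# P?) A ⟨
      # P? * suc A                                 ≡⟨ *-distribʳ-sum (suc A) (indicator ∘ P?) ⟩
      (sum λ x → indicator (P? x) * suc A)         ≤⟨ sum-mono pointwise ⟩
      (sum λ x → indicator (P? x) * f x * # P?)    ≡⟨ *-distribʳ-sum (# P?) (λ x → indicator (P? x) * f x) ⟨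
      (sum λ x → indicator (P? x) * f x) * # P?    ≤⟨ *-monoˡ-≤ (# P?) ∑≤A ⟩
      A * # P?                                     ≡⟨ *-comm A _ ⟩
      # P? * A                                     ∎

  sum-++ : ∀ m n (f : Fin (m + n) → ℕ) → sum f ≡ sum (λ i → f (i ↑ˡ n)) + sum (λ j → f (m ↑ʳ j))
  sum-++ zero    n f = refl
  sum-++ (suc m) n f = trans (cong (f zero +_) (sum-++ m n (f ∘ suc))) (sym (+-assoc (f zero) _ _))

  sum-combine : ∀ m n (f : Fin (m * n) → ℕ) → sum f ≡ sum λ i → sum λ j → f (combine {m} i j)
  sum-combine zero    n f = refl
  sum-combine (suc m) n f = trans (sum-++ n (m * n) f)
    (cong (sum (λ j → f (j ↑ˡ (m * n))) +_) (sum-combine m n (λ x → f (n ↑ʳ x))))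

  -- A greedy choice never gets stuck: with `m + 1` sets of size at least `m + 1`, the `m`
  -- representatives of the later sets leave an element of the first set free.
  system-of-distinct-representatives :
    ∀ {X : Fin m → Pred (Fin n) 0ℓ} (X? : ∀ j → Decidable (X j)) → (∀ j → m ≤ # (X? j)) →
    Σ[ f ∈ (Fin m → Fin n) ] (∀ j → X j (f j)) × Injective _≡_ _≡_ f
  system-of-distinct-representatives {zero}      X? large = (λ ()) , (λ ()) , λ { {()} }
  system-of-distinct-representatives {suc m} {n} {X} X? large =
    extend (system-of-distinct-representatives (X? ∘ suc) λ j → ≤-trans (n≤1+n m) (large (suc j)))
    where
    extend : Σ[ f ∈ (Fin m → Fin n) ] (∀ j → X (suc j) (f j)) × Injective _≡_ _≡_ f →
             Σ[ f ∈ (Fin (suc m) → Fin n) ] (∀ j → X j (f j)) × Injective _≡_ _≡_ f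
    extend (f , f∈X , f-inj)
      with #<#⇒∃ (λ y → any? (λ x → ⊤-dec {0ℓ} ×-dec f x ≟ y)) (X? zero)
           (≤-trans (s≤s (≤-trans (#-image (λ _ → ⊤-dec) f _) (≤-reflexive (#-all {m} (λ _ → ⊤-dec) _)))) (large zero))
    ... | y , y∈X , y∉f = y ∷ f , (λ { zero → y∈X ; (suc j) → f∈X j }) , g-inj
      where
      g-inj : Injective _≡_ _≡_ (y ∷ f)
      g-inj {zero}  {zero}  _  = refl
      g-inj {zero}  {suc j} eq = contradiction (j , _ , sym eq) y∉f
      g-inj {suc i} {zero}  eq = contradiction (i , _ , eq) y∉f
      g-inj {suc i} {suc j} eq = cong suc (f-inj eq)

-- Greedy assignment of distinct hooks with bounded load on every star.

module Greedy where

  open Counting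
  open import Data.Fin.Base using (Fin; zero; suc)
  open import Data.Fin.Properties using (any?; _≟_)
  open import Data.Nat.Base
  open import Data.Nat.Properties hiding (_≟_)
  open import Data.Nat.Tactic.RingSolver using (solve-∀)
  open import Data.Product.Base using (∃-syntax; _×_; _,_; proj₁; proj₂)
  open import Data.Sum.Base using (_⊎_; inj₁; inj₂; [_,_]′)
  open import Function.Base using (_∘_; const)
  open import Level using (0ℓ)
  open import Relation.Binary.PropositionalEquality
  open import Relation.Nullary using (¬_; yes; no; contradiction)
  open import Relation.Nullary.Decidable using (_×-dec_; ¬?; _⊎-dec_)
  open import Relation.Unary using (Pred; Decidable)

  -- In the application `Fin m` codes the pairs, `N x` is the set of hooks of the pair `x`, the
  -- `B i` are the stars, `F` is the body, and `ω x` is an upper bound for `M / # (N? x)`.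
  module GreedyAssignment
    {m n r : ℕ} (t M : ℕ) (0<M : 0 < M)
    {N : Fin m → Pred (Fin n) 0ℓ} (N? : ∀ x → Decidable (N x))
    {B : Fin r → Pred (Fin n) 0ℓ} (B? : ∀ i → Decidable (B i))
    (B-disjoint : ∀ {i j v} → B i v → B j v → i ≡ j) (#B≤4t : ∀ i → # (B? i) ≤ 4 * t)
    {F : Pred (Fin n) 0ℓ} (F? : Decidable F) (#F≤t : # F? ≤ t)
    (ω : Fin m → ℕ) (default : Fin n)
    where

    Used : Pred (Fin m) 0ℓ → (Fin m → Fin n) → Pred (Fin n) 0ℓ
    Used Q g v = ∃[ x ] Q x × g x ≡ v

    used? : ∀ {Q} → Decidable Q → ∀ g → Decidable (Used Q g)
    used? Q? g v = any? λ x → Q? x ×-dec g x ≟ v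

    record Assignment {Q : Pred (Fin m) 0ℓ} (Q? : Decidable Q) : Set where
      field
        hook      : Fin m → Fin n
        hook∈N    : ∀ {x} → Q x → N x (hook x)
        hook∉F    : ∀ {x} → Q x → ¬ F (hook x)
        injective : ∀ {x y} → Q x → Q y → hook x ≡ hook y → x ≡ y
        load≤t    : ∀ i → # (λ v → B? i v ×-dec used? Q? hook v) ≤ t

    -- The first bound pays for the vertices of `F`; the second turns a small weight into many
    -- hooks.
    Feasible : Fin m → Set
    Feasible x = 4 * t ≤ # (N? x) × M ≤ ω x * # (N? x)

    -- Division of `w * 9 * q ≤ M ≤ w * d` by `w`; the positive `M` excludes `w = 0`.
    cancel-weight : ∀ w {q d} → M ≤ w * d → w * 9 * q ≤ M → 9 * q ≤ d
    cancel-weight zero        M≤0  _    = contradiction 0<M (≤⇒≯ M≤0)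
    cancel-weight (suc w) {q} M≤wd w9q≤M = *-cancelˡ-≤ (suc w)
      (≤-trans (≤-reflexive (sym (*-assoc (suc w) 9 q))) (≤-trans w9q≤M M≤wd))

    -- The element `x` is hooked after all others of `Q`, so its hooks only have to outnumber the
    -- vertices blocked by `F` and by those others.
    module Step {Q : Pred (Fin m) 0ℓ} (Q? : Decidable Q) {x : Fin m} (x∈Q : Q x)
      (4t≤#N : 4 * t ≤ # (N? x)) (9#Q≤#N : 9 * # Q? ≤ # (N? x)) where

      Rest : Pred (Fin m) 0ℓ
      Rest y = Q y × y ≢ x

      rest? : Decidable Rest
      rest? y = Q? y ×-dec ¬? (y ≟ x)

      #rest<#Q : # rest? < # Q?
      #rest<#Q = #-strict rest? Q? proj₁ x∈Q λ x∈Rest → proj₂ x∈Rest refl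

      module _ (assigned : Assignment rest?) where
        open Assignment assigned

        load : Fin r → ℕ
        load i = # λ v → B? i v ×-dec used? rest? hook v

        -- Closing a star once t of its vertices are used forbids at most 4 vertices per hook.
        Saturated : Pred (Fin n) 0ℓ
        Saturated v = ∃[ i ] B i v × t ≤ load i

        saturated? : Decidable Saturated
        saturated? v = any? λ i → B? i v ×-dec t ≤? load i

        -- A saturated star has at most `4 * t` vertices and carries at least `t` hooks, hence at
        -- most four vertices per hook; as the stars are disjoint, no hook is charged twice.
        #saturated≤ : # saturated? ≤ 4 * # rest?
        #saturated≤ = begin
          # saturated?                                       ≤⟨ #-∃ saturated? (λ i v → B? i v ×-dec t ≤? load i) ⟩
          (sum λ i → # λ v → B? i v ×-dec t ≤? load i)       ≤⟨ sum-mono block ⟩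
          (sum λ i → 4 * load i)                             ≡⟨ *-distribˡ-sum 4 load ⟨
          4 * sum load                                       ≤⟨ *-monoʳ-≤ 4 (#-disjoint
                                                                  (λ i v → B? i v ×-dec used? rest? hook v) (used? rest? hook)
                                                                  proj₂ λ b b′ → B-disjoint (proj₁ b) (proj₁ b′)) ⟩
          4 * # (used? rest? hook)                           ≤⟨ *-monoʳ-≤ 4 (#-image rest? hook (used? rest? hook)) ⟩
          4 * # rest?                                        ∎
          where
          open ≤-Reasoning
          block : ∀ i → # (λ v → B? i v ×-dec t ≤? load i) ≤ 4 * load i
          block i with t ≤? load i
          ... | yes t≤load = ≤-trans (#-mono (λ v → B? i v ×-dec yes t≤load) (B? i) proj₁)
                               (≤-trans (#B≤4t i) (*-monoʳ-≤ 4 t≤load))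
          ... | no t≰load = ≤-trans
            (≤-reflexive (#-∅ (λ v → B? i v ×-dec no t≰load) λ v p → t≰load (proj₂ p))) z≤n

        Forbidden : Pred (Fin n) 0ℓ
        Forbidden v = F v ⊎ Used Rest hook v ⊎ Saturated v

        forbidden? : Decidable Forbidden
        forbidden? v = F? v ⊎-dec used? rest? hook v ⊎-dec saturated? v

        -- Four times the number of blocked vertices is at most `4 * t + 20 * # rest?`. Here `4 * t`
        -- is at most `# (N? x)`, and `20 * # Q?`, being at most `27 * # Q?`, is at most three times
        -- that.
        #forbidden< : # forbidden? < # (N? x)
        #forbidden< = *-cancelˡ-< 4 _ _ (begin-strict
          4 * # forbidden?
            ≤⟨ *-monoʳ-≤ 4 (#-⊎ forbidden? F? (λ v → used? rest? hook v ⊎-dec saturated? v) λ z → z) ⟩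
          4 * (# F? + # (λ v → used? rest? hook v ⊎-dec saturated? v))
            ≤⟨ *-monoʳ-≤ 4 (+-mono-≤ #F≤t (≤-trans
                 (#-⊎ (λ v → used? rest? hook v ⊎-dec saturated? v) (used? rest? hook) saturated? λ z → z)
                 (+-mono-≤ (#-image rest? hook (used? rest? hook)) #saturated≤))) ⟩
          4 * (t + (# rest? + 4 * # rest?))
            ≡⟨ regroup t (# rest?) ⟩
          4 * t + 20 * # rest?
            <⟨ +-monoʳ-< (4 * t) (*-monoʳ-< 20 #rest<#Q) ⟩
          4 * t + 20 * # Q?
            ≤⟨ +-mono-≤ 4t≤#N (≤-trans (*-monoˡ-≤ (# Q?) (m≤m+n 20 7))
                 (≤-trans (≤-reflexive (*-assoc 3 9 (# Q?))) (*-monoʳ-≤ 3 9#Q≤#N))) ⟩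
          4 * # (N? x) ∎)
          where
          open ≤-Reasoning
          regroup : ∀ t q → 4 * (t + (q + 4 * q)) ≡ 4 * t + 20 * q
          regroup = solve-∀

        choice : ∃[ v ] N x v × ¬ Forbidden v
        choice = #<#⇒∃ forbidden? (N? x) #forbidden<

        module _ {v : Fin n} (v∈N : N x v) (v-allowed : ¬ Forbidden v) where

          hook′ : Fin m → Fin n
          hook′ y with y ≟ x
          ... | yes _ = v
          ... | no _  = hook y

          hook∈N′ : ∀ {y} → Q y → N y (hook′ y)
          hook∈N′ {y} q with y ≟ x
          ... | yes refl = v∈N
          ... | no y≢x   = hook∈N (q , y≢x)

          hook∉F′ : ∀ {y} → Q y → ¬ F (hook′ y)
          hook∉F′ {y} q with y ≟ x
          ... | yes refl = v-allowed ∘ inj₁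
          ... | no y≢x   = hook∉F (q , y≢x)

          injective′ : ∀ {y z} → Q y → Q z → hook′ y ≡ hook′ z → y ≡ z
          injective′ {y} {z} p q eq with y ≟ x | z ≟ x
          ... | yes refl | yes refl = refl
          ... | yes refl | no z≢x   = contradiction (inj₂ (inj₁ (z , (q , z≢x) , sym eq))) v-allowed
          ... | no y≢x   | yes refl = contradiction (inj₂ (inj₁ (y , (p , y≢x) , eq))) v-allowed
          ... | no y≢x   | no z≢x   = injective (p , y≢x) (q , z≢x) eq

          used′⇒ : ∀ {w} → Used Q hook′ w → Used Rest hook w ⊎ w ≡ v
          used′⇒ (y , q , eq) with y ≟ x
          ... | yes refl = inj₂ (sym eq)
          ... | no y≢x   = inj₁ (y , (q , y≢x) , eq)

          load≤t′ : ∀ i → # (λ w → B? i w ×-dec used? Q? hook′ w) ≤ t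
          load≤t′ i with B? i v
          ... | yes v∈B = begin
            # (λ w → B? i w ×-dec used? Q? hook′ w)
              ≤⟨ #-⊎ _ (λ w → B? i w ×-dec used? rest? hook w) (_≟ v)
                   (λ (b , u) → [ (λ u′ → inj₁ (b , u′)) , inj₂ ]′ (used′⇒ u)) ⟩
            load i + # (_≟ v)
              ≤⟨ +-monoʳ-≤ (load i) (#-unique (_≟ v) λ p q → trans p (sym q)) ⟩
            load i + 1
              ≡⟨ +-comm (load i) 1 ⟩
            suc (load i)
              -- Were this star already full, `v` would be saturated and hence forbidden.
              ≤⟨ ≰⇒> (λ t≤load → v-allowed (inj₂ (inj₂ (i , v∈B , t≤load)))) ⟩
            t ∎
            where open ≤-Reasoning
          ... | no v∉B = ≤-trans
            (#-mono (λ w → B? i w ×-dec used? Q? hook′ w) (λ w → B? i w ×-dec used? rest? hook w)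
              λ { (b , u) → b , [ (λ u′ → u′) , (λ { refl → contradiction b v∉B }) ]′ (used′⇒ u) })
            (load≤t i)

          extended : Assignment Q?
          extended = record
            { hook = hook′ ; hook∈N = hook∈N′ ; hook∉F = hook∉F′ ; injective = injective′ ; load≤t = load≤t′ }

        extension : Assignment Q?
        extension = let (_ , v∈N , v-allowed) = choice in extended v∈N v-allowed

    -- By averaging, some `x` of `Q` satisfies `ω x * 9 * # Q? ≤ M ≤ ω x * # (N? x)`, so it has at
    -- least `9 * # Q?` hooks. It is set aside until the rest, whose total weight is no larger, has
    -- been hooked by induction.
    assign : ∀ {Q : Pred (Fin m) 0ℓ} (Q? : Decidable Q) → (∀ {x} → Q x → Feasible x) →
             (sum λ x → indicator (Q? x) * (ω x * 9)) ≤ M → Assignment Q?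
    assign Q? = go (# Q?) Q? ≤-refl
      where
      go : ∀ k {Q : Pred (Fin m) 0ℓ} (Q? : Decidable Q) → # Q? ≤ k → (∀ {x} → Q x → Feasible x) →
           (sum λ x → indicator (Q? x) * (ω x * 9)) ≤ M → Assignment Q?
      go zero Q? #Q≤0 feasible ∑≤M = record
        -- As `Q` is empty here, this arbitrary value never serves as a hook.
        { hook = const default
        ; hook∈N = λ q → contradiction (#-positive Q? q) (≤⇒≯ #Q≤0)
        ; hook∉F = λ q → contradiction (#-positive Q? q) (≤⇒≯ #Q≤0)
        ; injective = λ q → contradiction (#-positive Q? q) (≤⇒≯ #Q≤0)
        ; load≤t = λ i → ≤-trans (≤-reflexive (#-∅ (λ v → B? i v ×-dec used? Q? (const default) v)
            λ { v (_ , x , q , _) → contradiction (#-positive Q? q) (≤⇒≯ #Q≤0) })) z≤n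
        }
      go (suc k) {Q} Q? #Q≤1+k feasible ∑≤M with any? Q?
      -- An empty `Q` has size zero, so the smaller bound `k` also holds.
      ... | no ¬∃ = go k Q? (≤-trans (≤-reflexive (#-∅ Q? λ x q → ¬∃ (x , q))) z≤n) feasible ∑≤M
      ... | yes (_ , q₀) with below-average Q? (λ x → ω x * 9) (#-positive Q? q₀) ∑≤M
      ...   | x , x∈Q , ω9#Q≤M = Step.extension Q? x∈Q (proj₁ (feasible x∈Q)) 9#Q≤#N
                (go k rest? (≤-pred (≤-trans #rest<#Q #Q≤1+k)) (feasible ∘ proj₁)
                  (≤-trans (sum-mono λ y → *-monoˡ-≤ (ω y * 9) (indicator-mono (rest? y) (Q? y) proj₁)) ∑≤M))
        where
        9#Q≤#N : 9 * # Q? ≤ # (N? x)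
        9#Q≤#N = cancel-weight (ω x) (proj₂ (feasible x∈Q)) ω9#Q≤M
        open Step Q? x∈Q (proj₁ (feasible x∈Q)) 9#Q≤#N using (rest?; #rest<#Q)

-- Stars, weights, and bodies grown inside a shrinking vertex set.

module Bodies where

  open Counting
  open import Data.Bool.Base using (Bool; T; true; false)
  open import Data.Fin.Base as Fin using (Fin; zero; suc; opposite)
  open import Data.Fin.Properties using (any?; _≟_; opposite-involutive)
  open import Data.Nat.Base
  open import Data.Nat.Properties hiding (_≟_)
  open import Data.Nat.Tactic.RingSolver using (solve-∀)
  open import Data.Product.Base using (Σ-syntax; ∃-syntax; _×_; _,_; proj₁; proj₂)
  open import Data.Sum.Base using (_⊎_; inj₁; inj₂; [_,_]′)
  open import Data.Vec.Functional using (_∷_)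
  open import Function.Base using (_∘_; const)
  open import Level using (0ℓ)
  open import Relation.Binary.PropositionalEquality
  open import Relation.Nullary using (¬_; yes; no; contradiction; T?)
  open import Relation.Nullary.Decidable using (_×-dec_; ¬?; _⊎-dec_; ⌊_⌋; toWitness; fromWitness)
  open import Relation.Unary using (Pred; Decidable)

  ≢⇒≡opposite : ∀ {x c : Fin 2} → x ≢ c → x ≡ opposite c
  ≢⇒≡opposite {zero}     {zero}     x≢c = contradiction refl x≢c
  ≢⇒≡opposite {zero}     {suc zero} x≢c = refl
  ≢⇒≡opposite {suc zero} {zero}     x≢c = refl
  ≢⇒≡opposite {suc zero} {suc zero} x≢c = contradiction refl x≢c

  -- The first argument of `col` is the centre of a star, and the double count exchanges the other
  -- two. `K` is the index of the top scale.
  module BodyConstruction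
    {n : ℕ} (col : Fin n → Fin n → Fin n → Fin 2) (col-swap : ∀ u v w → col u v w ≡ col u w v) (t K : ℕ)
    where

    Hook : Fin 2 → Fin n → Fin n → Pred (Fin n) 0ℓ
    Hook c u v w = w ≢ u × w ≢ v × col u v w ≡ c

    hook? : ∀ c u v → Decidable (Hook c u v)
    hook? c u v w = ¬? (w ≟ u) ×-dec ¬? (w ≟ v) ×-dec col u v w ≟ c

    degree : Fin 2 → Fin n → Fin n → ℕ
    degree c u v = # (hook? c u v)

    scale : ℕ → ℕ
    scale s = 4 * t * 2 ^ s

    scale-suc : ∀ s → scale (suc s) ≡ 2 * scale s
    scale-suc s = arith t (2 ^ s)
      where
      arith : ∀ t p → 4 * t * (2 * p) ≡ 2 * (4 * t * p)
      arith = solve-∀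

    scale-0 : scale 0 ≡ 4 * t
    scale-0 = *-identityʳ (4 * t)

    scale-mono : ∀ {r s} → r ≤ s → scale r ≤ scale s
    scale-mono r≤s = *-monoʳ-≤ (4 * t) (^-monoʳ-≤ 2 r≤s)

    VSet : Set
    VSet = Fin n → Bool

    record Entry : Set where
      constructor _with-star_
      field
        vertex : Fin n
        star   : VSet
    open Entry public

    StarHook : Fin 2 → Entry → Fin n → Pred (Fin n) 0ℓ
    StarHook c e w v = T (star e v) × col (vertex e) w v ≡ c

    starHook? : ∀ c e w → Decidable (StarHook c e w)
    starHook? c e w v = T? (star e v) ×-dec col (vertex e) w v ≟ c

    -- The margin `2 * t` consists of `t` vertices that hooks of bad pairs may occupy in the star,
    -- and `t` that remain for choosing distinct representatives.
    Bad : Fin 2 → Entry → Pred (Fin n) 0ℓ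
    Bad c e w = # (starHook? c e w) < 2 * t

    bad? : ∀ c e → Decidable (Bad c e)
    bad? c e w = # (starHook? c e w) <? 2 * t

    degree<? : ∀ c u s → Decidable λ w → degree c u w < scale s
    degree<? c u s w = degree c u w <? scale s

    Exceptional : VSet → Fin 2 → Entry → ℕ → Pred (Fin n) 0ℓ
    Exceptional V c e s w = T (V w) × Bad c e w × degree c (vertex e) w < scale s

    exceptional? : ∀ V c e s → Decidable (Exceptional V c e s)
    exceptional? V c e s w = T? (V w) ×-dec bad? c e w ×-dec degree<? c (vertex e) s w

    Outside : VSet → Entry → Pred (Fin n) 0ℓ
    Outside V e w = T (V w) × w ≢ vertex e × ¬ T (star e w)

    outside? : ∀ V e → Decidable (Outside V e)
    outside? V e w = T? (V w) ×-dec ¬? (w ≟ vertex e) ×-dec ¬? (T? (star e w))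

    _─_ : VSet → Entry → VSet
    (V ─ e) w = ⌊ outside? V e w ⌋

    ∈─⇒ : ∀ V e {w} → T ((V ─ e) w) → Outside V e w
    ∈─⇒ _ _ = toWitness

    record Local (V : VSet) (c : Fin 2) (e : Entry) : Set where
      field
        star⊆  : ∀ {v} → T (star e v) → T (V v) × v ≢ vertex e
        #star≤ : # (T? ∘ star e) ≤ 4 * t
        sparse : ∀ {s} → s ≤ K → # (exceptional? (V ─ e) c e s) ≤ 2 * scale s

    -- The star of a vertex, chosen at the least violated scale.

    module _ (0<t : 0 < t) (V : VSet) (u : Fin n) where

      Low : Fin 2 → ℕ → Pred (Fin n) 0ℓ
      Low c s v = (T (V v) × v ≢ u) × degree c u v < scale s

      low? : ∀ c s → Decidable (Low c s)
      low? c s v = (T? (V v) ×-dec ¬? (v ≟ u)) ×-dec degree<? c u s v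

      Violated : Fin 2 → ℕ → Set
      Violated c s = 2 * scale s < # (low? c s)

      -- Minimality is recorded for both colours, because a violation in one colour yields a star
      -- for the opposite one.
      first-violation : ∀ k → (∀ s → s < k → ∀ c → ¬ Violated c s) ⊎
        (∃[ s ] ∃[ c ] Violated c s × ∀ r → r < s → ∀ c → ¬ Violated c r)
      first-violation zero = inj₁ λ _ ()
      first-violation (suc k) with first-violation k
      ... | inj₂ found = inj₂ found
      ... | inj₁ none with any? (λ c → 2 * scale k <? # (low? c k))
      ...   | yes (c , violated) = inj₂ (k , c , violated , none)
      ...   | no ¬violated = inj₁ λ s s<1+k c → [ (λ s<k → none s s<k c) , (λ { refl v → ¬violated (c , v) }) ]′
                (m≤n⇒m<n∨m≡n (≤-pred s<1+k))

      not-violated⇒sparse : ∀ {c e} s → vertex e ≡ u → ¬ Violated c s →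
                            # (exceptional? (V ─ e) c e s) ≤ 2 * scale s
      not-violated⇒sparse {c} {e} s refl ¬violated = ≤-trans
        (#-mono (exceptional? (V ─ e) c e s) (low? c s)
          λ (w∈ , _ , low) → let (w∈V , w≢u , _) = ∈─⇒ V e w∈ in (w∈V , w≢u) , low)
        (≮⇒≥ ¬violated)

      module _ {c : Fin 2} {s : ℕ} {B : VSet} (B⊆Low : ∀ v → T (B v) → Low c s v) (#B : # (T? ∘ B) ≡ 4 * t) where

        private
          e : Entry
          e = u with-star B

          bad∖? : Decidable λ w → T ((V ─ e) w) × Bad (opposite c) e w
          bad∖? w = T? ((V ─ e) w) ×-dec bad? (opposite c) e w

          Meets : Fin n → Pred (Fin n) 0ℓ
          Meets w v = (T ((V ─ e) w) × Bad (opposite c) e w) × T (B v) × col u v w ≡ c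

          meets? : ∀ w → Decidable (Meets w)
          meets? w v = bad∖? w ×-dec T? (B v) ×-dec col u v w ≟ c

          ≢opposite⇒≡ : ∀ {x} → x ≢ opposite c → x ≡ c
          ≢opposite⇒≡ x≢ = trans (≢⇒≡opposite x≢) (opposite-involutive c)

          -- Of the `4 * t` vertices of `B`, fewer than `2 * t` have the opposite colour with `u`
          -- and a bad `w`; all others have colour `c`.
          bad-meets : ∀ w → indicator (bad∖? w) * (2 * t) ≤ # (meets? w)
          bad-meets w with bad∖? w
          ... | no _ = z≤n
          ... | yes (w∈V , bad) = begin
            1 * (2 * t)  ≡⟨ *-identityˡ _ ⟩
            2 * t        ≤⟨ +-cancelˡ-≤ (2 * t) _ _ (begin
              2 * t + 2 * t                             ≡⟨ arith t ⟩
              4 * t                                     ≡⟨ #B ⟨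
              # (T? ∘ B)                                ≤⟨ #-⊎ (T? ∘ B) (starHook? (opposite c) e w) meets split ⟩
              # (starHook? (opposite c) e w) + # meets  ≤⟨ +-monoˡ-≤ (# meets) (<⇒≤ bad) ⟩
              2 * t + # meets                           ∎) ⟩
            # meets      ∎
            where
            open ≤-Reasoning
            arith : ∀ t → 2 * t + 2 * t ≡ 4 * t
            arith = solve-∀
            meets : Decidable (Meets w)
            meets v = yes (w∈V , bad) ×-dec T? (B v) ×-dec col u v w ≟ c
            split : ∀ {v} → T (B v) → StarHook (opposite c) e w v ⊎ Meets w v
            split {v} v∈B with col u w v ≟ opposite c
            ... | yes eq = inj₁ (v∈B , eq)
            ... | no neq = inj₂ ((w∈V , bad) , v∈B , trans (col-swap u v w) (≢opposite⇒≡ neq))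

          -- The vertices `w` counted here are hooks for `u` and `v` in colour `c`: they differ from
          -- `u` and, lying outside `B`, from `v`. The low degree of `v` bounds their number.
          met-few : ∀ v → # (λ w → meets? w v) ≤ indicator (T? (B v)) * scale s
          met-few v with T? (B v)
          ... | no v∉B  = ≤-reflexive
            (#-∅ (λ w → bad∖? w ×-dec no v∉B ×-dec col u v w ≟ c) λ w (_ , v∈B , _) → v∉B v∈B)
          ... | yes v∈B = ≤-trans
            (#-mono (λ w → bad∖? w ×-dec yes v∈B ×-dec col u v w ≟ c) (hook? c u v)
              λ ((w∈ , _) , _ , eq) →
                let (_ , w≢u , w∉B) = ∈─⇒ V e w∈ in w≢u , (λ { refl → w∉B v∈B }) , eq)
            (≤-trans (<⇒≤ (proj₂ (B⊆Low v v∈B))) (≤-reflexive (sym (*-identityˡ _))))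

        -- Double counting of the triples of colour `c` through `u`, a bad `w` and a star vertex
        -- `v`: at least `2 * t` for each `w`, at most `scale s` for each of the `4 * t` vertices
        -- `v`.
        few-bad : # bad∖? ≤ 2 * scale s
        few-bad = *-cancelˡ-≤ (2 * t) ⦃ >-nonZero (≤-trans 0<t (m≤m+n t (t + 0))) ⦄ (begin
          2 * t * # bad∖?                                ≡⟨ *-comm (2 * t) _ ⟩
          # bad∖? * (2 * t)                              ≡⟨ *-distribʳ-sum (2 * t) (indicator ∘ bad∖?) ⟩
          (sum λ w → indicator (bad∖? w) * (2 * t))      ≤⟨ sum-mono bad-meets ⟩
          (sum λ w → # (meets? w))                       ≡⟨ ∑-comm (λ w v → indicator (meets? w v)) ⟩
          (sum λ v → # (λ w → meets? w v))               ≤⟨ sum-mono met-few ⟩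
          (sum λ v → indicator (T? (B v)) * scale s)     ≡⟨ *-distribʳ-sum (scale s) (indicator ∘ T? ∘ B) ⟨
          # (T? ∘ B) * scale s                           ≡⟨ cong (_* scale s) #B ⟩
          4 * t * scale s                                ≡⟨ arith t (scale s) ⟩
          2 * t * (2 * scale s)                          ∎)
          where
          open ≤-Reasoning
          arith : ∀ t x → 4 * t * x ≡ 2 * t * (2 * x)
          arith = solve-∀

        -- Below `s` sparseness comes from the minimality of `s`; from `s` on, the bound on all bad
        -- vertices suffices.
        local-star : (∀ r → r < s → ∀ c → ¬ Violated c r) → Local V (opposite c) e
        local-star minimal = record
          { star⊆  = λ {v} → proj₁ ∘ B⊆Low v
          ; #star≤ = ≤-reflexive #B
          ; sparse = λ {r} _ → case-r r
          }
          where
          case-r : ∀ r → # (exceptional? (V ─ e) (opposite c) e r) ≤ 2 * scale r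
          case-r r with r <? s
          ... | yes r<s = not-violated⇒sparse r refl (minimal r r<s (opposite c))
          ... | no r≮s  = begin
            # (exceptional? (V ─ e) (opposite c) e r)  ≤⟨ #-mono (exceptional? (V ─ e) (opposite c) e r) bad∖?
                                                            (λ (w∈V , bad , _) → w∈V , bad) ⟩
            # bad∖?                                    ≤⟨ few-bad ⟩
            2 * scale s                                ≤⟨ *-monoʳ-≤ 2 (scale-mono {s} {r} (≮⇒≥ r≮s)) ⟩
            2 * scale r                                ∎
            where open ≤-Reasoning

      local : ∃[ c ] Σ[ B ∈ VSet ] Local V c (u with-star B)
      local with first-violation (suc K)
      -- The colour is arbitrary, since no scale up to `K` is violated in either colour.
      ... | inj₁ none = zero , const false , record
        { star⊆  = λ ()
        ; #star≤ = ≤-trans (≤-reflexive (#-∅ {n} (λ _ → T? false) λ _ ())) z≤n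
        ; sparse = λ {s} s≤K → not-violated⇒sparse s refl (none s (s≤s s≤K) zero)
        }
      ... | inj₂ (s , c , violated , minimal) =
        let (B , B⊆Low , #B) = subset-of-size (low? c s) (≤-trans 4t≤2scale (<⇒≤ violated))
        in opposite c , B , local-star B⊆Low #B minimal
        where
        4t≤2scale : 4 * t ≤ 2 * scale s
        4t≤2scale = begin
          4 * t        ≡⟨ scale-0 ⟨
          scale 0      ≤⟨ scale-mono {s = s} z≤n ⟩
          scale s      ≤⟨ m≤m+n _ _ ⟩
          2 * scale s  ∎
          where open ≤-Reasoning

    -- For i < k and scale i ≤ d < scale (suc i) the value is 2^(k − i) − 1.
    wt : ℕ → ℕ → ℕ
    wt zero    d = 0
    wt (suc k) d = 2 * wt k d + indicator (d <? scale (suc k))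

    -- Below `scale k`, one more than the weight is the power of two that lifts the scale of `d` to
    -- `scale k`; from `scale k` on it is one.
    scale≤wt*d : ∀ k {d} → scale 0 ≤ d → scale k ≤ suc (wt k d) * d
    scale≤wt*d zero    {d} low = ≤-trans low (≤-reflexive (sym (*-identityˡ d)))
    scale≤wt*d (suc k) {d} low with d <? scale (suc k)
    ... | no d≮  = ≤-trans (≮⇒≥ d≮) (m≤m+n d _)
    ... | yes _  = begin
      scale (suc k)               ≡⟨ scale-suc k ⟩
      2 * scale k                 ≤⟨ *-monoʳ-≤ 2 (scale≤wt*d k low) ⟩
      2 * (suc (wt k d) * d)      ≡⟨ arith (wt k d) d ⟩
      suc (2 * wt k d + 1) * d    ∎
      where
      open ≤-Reasoning
      arith : ∀ x d → 2 * (suc x * d) ≡ suc (2 * x + 1) * d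
      arith = solve-∀

    ω : Fin 2 → Entry → Fin n → ℕ
    ω c e w = indicator (bad? c e w) * wt K (degree c (vertex e) w)

    -- Unrolled, the weight adds `2 ^ (k ∸ j)` for every scale `j` from `1` to `k` at which the
    -- degree is low. Sparseness bounds the contribution of `j` by `2 ^ (k ∸ j) * (2 * scale j)`,
    -- which is `2 * scale k` for every `j`.
    ∑-wt : ∀ V c e k → (∀ {s} → s ≤ k → # (exceptional? V c e s) ≤ 2 * scale s) →
           (sum λ w → indicator (T? (V w)) * (indicator (bad? c e w) * wt k (degree c (vertex e) w))) ≤ k * (2 * scale k)
    ∑-wt V c e zero    sparse = ≤-reflexive (trans
      (sum-cong-≗ λ w → trans
        (cong (indicator (T? (V w)) *_) (*-zeroʳ (indicator (bad? c e w))))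
        (*-zeroʳ (indicator (T? (V w)))))
      (sum-replicate-zero n))
    ∑-wt V c e (suc k) sparse = begin
      (sum λ w → indicator (T? (V w)) * (indicator (bad? c e w) * wt (suc k) (d w)))
        ≤⟨ sum-mono pointwise ⟩
      (sum λ w → 2 * term w + indicator (exceptional? V c e (suc k) w))
        ≡⟨ ∑-distrib-+ (λ w → 2 * term w) _ ⟩
      (sum λ w → 2 * term w) + # (exceptional? V c e (suc k))
        ≡⟨ cong (_+ # (exceptional? V c e (suc k))) (*-distribˡ-sum 2 term) ⟨
      2 * sum term + # (exceptional? V c e (suc k))
        ≤⟨ +-mono-≤ (*-monoʳ-≤ 2 (∑-wt V c e k λ s≤k → sparse (m≤n⇒m≤1+n s≤k))) (sparse ≤-refl) ⟩
      2 * (k * (2 * scale k)) + 2 * scale (suc k)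
        ≡⟨ cong (λ x → 2 * (k * (2 * scale k)) + 2 * x) (scale-suc k) ⟩
      2 * (k * (2 * scale k)) + 2 * (2 * scale k)
        ≡⟨ arith k (scale k) ⟩
      suc k * (2 * (2 * scale k))
        ≡⟨ cong (λ x → suc k * (2 * x)) (scale-suc k) ⟨
      suc k * (2 * scale (suc k)) ∎
      where
      open ≤-Reasoning
      arith : ∀ k x → 2 * (k * (2 * x)) + 2 * (2 * x) ≡ suc k * (2 * (2 * x))
      arith = solve-∀
      d : Fin n → ℕ
      d w = degree c (vertex e) w
      term : Fin n → ℕ
      term w = indicator (T? (V w)) * (indicator (bad? c e w) * wt k (d w))
      unit : ∀ x y → 1 * (1 * (2 * x + y)) ≡ 2 * (1 * (1 * x)) + y
      unit = solve-∀
      pointwise : ∀ w → indicator (T? (V w)) * (indicator (bad? c e w) * wt (suc k) (d w)) ≤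
                        2 * term w + indicator (exceptional? V c e (suc k) w)
      pointwise w with T? (V w) | bad? c e w | degree<? c (vertex e) (suc k) w
      ... | no _  | _     | _     = z≤n
      ... | yes _ | no _  | _     = z≤n
      ... | yes _ | yes _ | yes _ = ≤-reflexive (unit (wt k (d w)) 1)
      ... | yes _ | yes _ | no _  = ≤-reflexive (unit (wt k (d w)) 0)

    -- Bodies and their extension by one vertex.

    record Fits (V : VSet) (c : Fin 2) (e : Entry) : Set where
      field
        outside : ∀ {w} → T (V w) → w ≢ vertex e × ¬ T (star e w)
        high    : ∀ {w} → T (V w) → Bad c e w → scale 0 ≤ degree c (vertex e) w
        sparse  : ∀ {s} → s ≤ K → # (exceptional? V c e s) ≤ 2 * scale s

    Fits-⊆ : ∀ {V W c e} → (∀ {w} → T (W w) → T (V w)) → Fits V c e → Fits W c e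
    Fits-⊆ {V} {W} {c} {e} W⊆V fits = record
      { outside = outside ∘ W⊆V
      ; high    = high ∘ W⊆V
      ; sparse  = λ {s} s≤K → ≤-trans
          (#-mono (exceptional? W c e s) (exceptional? V c e s) λ (w∈W , rest) → W⊆V w∈W , rest) (sparse s≤K)
      }
      where open Fits fits

    -- A pair is hooked from the star of its older vertex, so badness and degree are taken at `old`.
    record Compatible (c : Fin 2) (new old : Entry) : Set where
      field
        distinct    : vertex new ≢ vertex old
        new∉old     : ¬ T (star old (vertex new))
        old∉new     : ¬ T (star new (vertex old))
        disjoint    : ∀ {v} → T (star new v) → ¬ T (star old v)
        high-degree : Bad c old (vertex new) → scale 0 ≤ degree c (vertex old) (vertex new)

    weight : ∀ {m} → Fin 2 → (Fin m → Entry) → ℕ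
    weight {zero}  c es = 0
    weight {suc m} c es = (sum λ j → ω c (es (suc j)) (vertex (es zero))) + weight c (es ∘ suc)

    -- `N` is a lower bound for the eligible set during the growth. Each added vertex then costs at
    -- most `4 * t * K * scale K / N`, which the field `light` accumulates.
    module _ (N : ℕ) where

      -- The newest entry comes first.
      record Body (V : VSet) (c : Fin 2) (m : ℕ) : Set where
        field
          entry      : Fin m → Entry
          fits       : ∀ i → Fits V c (entry i)
          compatible : ∀ {i j} → i Fin.< j → Compatible c (entry i) (entry j)
          #star≤     : ∀ i → # (T? ∘ star (entry i)) ≤ 4 * t
          light      : weight c entry * N ≤ m * (4 * t * K * scale K)
          star∌self  : ∀ i → ¬ T (star (entry i) (vertex (entry i)))

      Body-⊆ : ∀ {V W c m} → (∀ {w} → T (W w) → T (V w)) → Body V c m → Body W c m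
      Body-⊆ W⊆V b = record
        { entry = entry ; fits = Fits-⊆ W⊆V ∘ fits ; compatible = compatible
        ; #star≤ = #star≤ ; light = light ; star∌self = star∌self }
        where open Body b

      empty : ∀ V c → Body V c 0
      empty V c = record
        { entry = λ () ; fits = λ () ; compatible = λ { {()} } ; #star≤ = λ () ; light = z≤n ; star∌self = λ () }

      cost : ∀ {V c m} → Body V c m → Fin n → ℕ
      cost {c = c} b w = sum λ j → ω c (Body.entry b j) w

      module _ {V : VSet} {c : Fin 2} {e : Entry} (u∈V : T (V (vertex e))) (loc : Local V c e) where
        open Local loc

        -- Bad vertices of degree below `scale 0` are dropped at once, so that every later bad pair
        -- at this vertex has at least `4 * t` hooks.
        Kept : Pred (Fin n) 0ℓ
        Kept w = Outside V e w × ¬ (Bad c e w × degree c (vertex e) w < scale 0)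

        kept? : Decidable Kept
        kept? w = outside? V e w ×-dec ¬? (bad? c e w ×-dec degree<? c (vertex e) 0 w)

        keep : VSet
        keep w = ⌊ kept? w ⌋

        kept : ∀ {w} → T (keep w) → Kept w
        kept = toWitness

        keep⊆ : ∀ {w} → T (keep w) → T (V w)
        keep⊆ w∈ = proj₁ (proj₁ (kept w∈))

        -- The loss is one for the vertex, `4 * t` for its star and `8 * t` for the exceptional
        -- vertices at scale zero.
        #keep : # (T? ∘ V) ≤ # (T? ∘ keep) + suc (12 * t)
        #keep = begin
          # (T? ∘ V)
            ≤⟨ #-⊎ (T? ∘ V) (T? ∘ keep) removed? split ⟩
          # (T? ∘ keep) + # removed?
            ≤⟨ +-monoʳ-≤ (# (T? ∘ keep)) (#-⊎ removed? (_≟ vertex e) starOrLow? λ z → z) ⟩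
          # (T? ∘ keep) + (# (_≟ vertex e) + # starOrLow?)
            ≤⟨ +-monoʳ-≤ (# (T? ∘ keep)) (+-mono-≤ (#-unique (_≟ vertex e) λ p q → trans p (sym q))
                 (≤-trans (#-⊎ starOrLow? (T? ∘ star e) (exceptional? (V ─ e) c e 0) λ z → z)
                   (+-mono-≤ #star≤ (≤-trans (sparse z≤n) (≤-reflexive (cong (2 *_) scale-0)))))) ⟩
          # (T? ∘ keep) + (1 + (4 * t + 2 * (4 * t)))
            ≡⟨ cong (λ x → # (T? ∘ keep) + suc x) (arith t) ⟩
          # (T? ∘ keep) + suc (12 * t) ∎
          where
          open ≤-Reasoning
          arith : ∀ t → 4 * t + 2 * (4 * t) ≡ 12 * t
          arith = solve-∀
          Removed : Pred (Fin n) 0ℓ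
          Removed w = w ≡ vertex e ⊎ T (star e w) ⊎ Exceptional (V ─ e) c e 0 w
          starOrLow? : Decidable λ w → T (star e w) ⊎ Exceptional (V ─ e) c e 0 w
          starOrLow? w = T? (star e w) ⊎-dec exceptional? (V ─ e) c e 0 w
          removed? : Decidable Removed
          removed? w = w ≟ vertex e ⊎-dec starOrLow? w
          split : ∀ {w} → T (V w) → T (keep w) ⊎ Removed w
          split {w} w∈V with w ≟ vertex e | T? (star e w) | bad? c e w | degree<? c (vertex e) 0 w
          ... | yes eq | _      | _      | _       = inj₂ (inj₁ eq)
          ... | no _   | yes w∈ | _      | _       = inj₂ (inj₂ (inj₁ w∈))
          ... | no w≢  | no w∉  | yes b  | yes low = inj₂ (inj₂ (inj₂ (fromWitness (w∈V , w≢ , w∉) , b , low)))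
          ... | no w≢  | no w∉  | no ¬b  | _       = inj₁ (fromWitness ((w∈V , w≢ , w∉) , λ (b , _) → ¬b b))
          ... | no w≢  | no w∉  | yes _  | no high = inj₁ (fromWitness ((w∈V , w≢ , w∉) , λ (_ , low) → high low))

        fits-new : Fits keep c e
        fits-new = record
          { outside = λ w∈ → proj₂ (proj₁ (kept w∈))
          ; high    = λ w∈ b → ≮⇒≥ λ low → proj₂ (kept w∈) (b , low)
          ; sparse  = λ {s} s≤K → ≤-trans
              (#-mono (exceptional? keep c e s) (exceptional? (V ─ e) c e s)
                λ (w∈ , rest) → fromWitness (proj₁ (kept w∈)) , rest)
              (sparse s≤K)
          }

        extend : ∀ {m} (b : Body V c m) → cost b (vertex e) * N ≤ 4 * t * K * scale K → Body keep c (suc m)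
        extend {m} b cheap = record
          { entry      = entry′
          ; fits       = λ { zero → fits-new ; (suc i) → Fits-⊆ keep⊆ (fits i) }
          ; compatible = λ {i} {j} → compatible′ i j
          ; #star≤     = λ { zero → #star≤ ; (suc i) → B.#star≤ i }
          ; light      = ≤-trans (≤-reflexive (*-distribʳ-+ N (cost b (vertex e)) (weight c entry))) (+-mono-≤ cheap light)
          ; star∌self  = λ { zero self → proj₂ (star⊆ self) refl ; (suc i) → star∌self i }
          }
          where
          module B = Body b
          open Body b using (entry; fits; compatible; light; star∌self)
          entry′ : Fin (suc m) → Entry
          entry′ = e ∷ entry
          -- Only pairs with the new entry need an argument: its vertex and star lie in `V`, which
          -- every older entry fits.
          compatible′ : ∀ i j → i Fin.< j → Compatible c (entry′ i) (entry′ j)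
          compatible′ zero (suc j) _ = record
            { distinct    = proj₁ (outside u∈V)
            ; new∉old     = proj₂ (outside u∈V)
            ; old∉new     = λ u∈ → proj₁ (outside (proj₁ (star⊆ u∈))) refl
            ; disjoint    = λ v∈ → proj₂ (outside (proj₁ (star⊆ v∈)))
            ; high-degree = high u∈V
            }
            where open Fits (fits j) using (outside; high)
          compatible′ (suc i) (suc j) i<j = compatible (≤-pred i<j)

      -- Growing two bodies until one of them is complete.

      module _ (0<t : 0 < t) (0<N : 0 < N) where

        Type : VSet → Fin 2 → Pred (Fin n) 0ℓ
        Type V c u = T (V u) × proj₁ (local 0<t V u) ≡ c

        type? : ∀ V c → Decidable (Type V c)
        type? V c u = T? (V u) ×-dec proj₁ (local 0<t V u) ≟ c

        local-of-type : ∀ {V c u} → Type V c u → Σ[ B ∈ VSet ] Local V c (u with-star B)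
        local-of-type {V} {c} {u} (_ , refl) = proj₂ (local 0<t V u)

        some-type : ∀ {V u} c → T (V u) → proj₁ (local 0<t V u) ≡ c → Type V zero u ⊎ Type V (suc zero) u
        some-type zero       u∈V eq = inj₁ (u∈V , eq)
        some-type (suc zero) u∈V eq = inj₂ (u∈V , eq)

        #types : ∀ V → # (T? ∘ V) ≤ # (type? V zero) + # (type? V (suc zero))
        #types V = #-⊎ (T? ∘ V) (type? V zero) (type? V (suc zero)) λ u∈V → some-type _ u∈V refl

        majority : ∀ V → # (T? ∘ V) ≤ 2 * # (type? V zero) ⊎ # (T? ∘ V) ≤ 2 * # (type? V (suc zero))
        majority V = decide (# (type? V zero)) (# (type? V (suc zero))) (#types V)
          where
          double : ∀ x → x + x ≡ 2 * x
          double = solve-∀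
          decide : ∀ x y {z} → z ≤ x + y → z ≤ 2 * x ⊎ z ≤ 2 * y
          decide x y z≤x+y with ≤-total x y
          ... | inj₁ x≤y = inj₂ (≤-trans z≤x+y (≤-trans (+-monoˡ-≤ y x≤y) (≤-reflexive (double y))))
          ... | inj₂ y≤x = inj₁ (≤-trans z≤x+y (≤-trans (+-monoʳ-≤ x y≤x) (≤-reflexive (double x))))

        ∑-cost : ∀ {V c m} (b : Body V c m) →
                 (sum λ w → indicator (type? V c w) * cost b w) ≤ m * (K * (2 * scale K))
        ∑-cost {V} {c} {m} b = begin
          (sum λ w → indicator (type? V c w) * cost b w)
            ≤⟨ sum-mono (λ w → *-monoˡ-≤ (cost b w) (indicator-mono (type? V c w) (T? (V w)) proj₁)) ⟩
          (sum λ w → indicator (T? (V w)) * cost b w)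
            ≡⟨ sum-cong-≗ (λ w → *-distribˡ-sum (indicator (T? (V w))) (λ j → ω c (entry j) w)) ⟩
          (sum λ w → sum λ j → indicator (T? (V w)) * ω c (entry j) w)
            ≡⟨ ∑-comm (λ w j → indicator (T? (V w)) * ω c (entry j) w) ⟩
          (sum λ j → sum λ w → indicator (T? (V w)) * ω c (entry j) w)
            ≤⟨ sum-replicate-≤ m _ (λ j → ∑-wt V c (entry j) K (Fits.sparse (fits j))) ⟩
          m * (K * (2 * scale K)) ∎
          where
          open ≤-Reasoning
          open Body b

        -- The type fills at least half of `V`, so it has at least `N / 2` vertices, and averaging
        -- `∑-cost` over it finds a vertex of cost at most `t * K * (2 * scale K)` divided by
        -- `N / 2`.
        extend-majority : ∀ {V c m} → Body V c m → m < t → N ≤ # (T? ∘ V) → # (T? ∘ V) ≤ 2 * # (type? V c) →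
          Σ[ W ∈ VSet ] (∀ {w} → T (W w) → T (V w)) × # (T? ∘ V) ≤ # (T? ∘ W) + suc (12 * t) × Body W c (suc m)
        extend-majority {V} {c} {m} b m<t N≤#V #V≤2#Type =
          conclude (below-average (type? V c) (cost b) 0<#Type (∑-cost b))
          where
          open ≤-Reasoning
          0<#Type : 0 < # (type? V c)
          0<#Type = *-cancelˡ-< 2 _ _ (≤-trans 0<N (≤-trans N≤#V #V≤2#Type))
          cheap : ∀ {w} → cost b w * # (type? V c) ≤ m * (K * (2 * scale K)) → cost b w * N ≤ 4 * t * K * scale K
          cheap {w} below = begin
            cost b w * N                        ≤⟨ *-monoʳ-≤ (cost b w) (≤-trans N≤#V #V≤2#Type) ⟩
            cost b w * (2 * # (type? V c))      ≡⟨ swap (cost b w) (# (type? V c)) ⟩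
            2 * (cost b w * # (type? V c))      ≤⟨ *-monoʳ-≤ 2 (≤-trans below (*-monoˡ-≤ (K * (2 * scale K)) (<⇒≤ m<t))) ⟩
            2 * (t * (K * (2 * scale K)))       ≡⟨ regroup t K (scale K) ⟩
            4 * t * K * scale K                 ∎
            where
            swap : ∀ x y → x * (2 * y) ≡ 2 * (x * y)
            swap = solve-∀
            regroup : ∀ t K x → 2 * (t * (K * (2 * x))) ≡ 4 * t * K * x
            regroup = solve-∀
          conclude : (∃[ w ] Type V c w × cost b w * # (type? V c) ≤ m * (K * (2 * scale K))) → _
          conclude (w , w∈Type , below) =
            let (B , loc) = local-of-type w∈Type
                w∈V = proj₁ w∈Type
            in keep w∈V loc , (λ {x} → keep⊆ w∈V loc {x}) , #keep w∈V loc , extend w∈V loc b (cheap below)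

        shrunk : ∀ k {v w} → N + suc k * suc (12 * t) ≤ v → v ≤ w + suc (12 * t) → N + k * suc (12 * t) ≤ w
        shrunk k large v≤ = +-cancelʳ-≤ (suc (12 * t)) _ _
          (≤-trans (≤-reflexive (arith N k (suc (12 * t)))) (≤-trans large v≤))
          where
          arith : ∀ N k x → N + k * x + x ≡ N + suc k * x
          arith = solve-∀

        -- `k` counts the remaining steps. A step enlarges one body, restricts the other to the
        -- smaller set, and loses at most `12 * t + 1` eligible vertices; after `t + t` steps in
        -- all, one body must have reached size `t`.
        grow : ∀ k {V a b} → Body V zero a → Body V (suc zero) b → a ≤ t → b ≤ t → a + b + k ≡ t + t →
               N + k * suc (12 * t) ≤ # (T? ∘ V) → Σ[ c ∈ Fin 2 ] Σ[ W ∈ VSet ] Body W c t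
        grow k {V} {a} {b} red blue a≤t b≤t total large with m≤n⇒m<n∨m≡n a≤t | m≤n⇒m<n∨m≡n b≤t
        ... | inj₂ refl | _         = zero , V , red
        ... | inj₁ _    | inj₂ refl = suc zero , V , blue
        grow zero {V} {a} {b} red blue a≤t b≤t total large | inj₁ a<t | inj₁ b<t =
          contradiction (trans (sym (+-identityʳ (a + b))) total) (<⇒≢ (+-mono-< a<t b<t))
        grow (suc k) {V} {a} {b} red blue a≤t b≤t total large | inj₁ a<t | inj₁ b<t with majority V
        ... | inj₁ most =
          let (W , W⊆V , #W , red′) = extend-majority red a<t (≤-trans (m≤m+n N _) large) most
          in grow k red′ (Body-⊆ (λ {x} → W⊆V {x}) blue) a<t b≤t
               (trans (sym (+-suc (a + b) k)) total) (shrunk k large #W)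
        ... | inj₂ most =
          let (W , W⊆V , #W , blue′) = extend-majority blue b<t (≤-trans (m≤m+n N _) large) most
          in grow k (Body-⊆ (λ {x} → W⊆V {x}) red) blue′ a≤t b<t
               (trans (cong (_+ k) (+-suc a b)) (trans (sym (+-suc (a + b) k)) total)) (shrunk k large #W)

        complete-body : N + (t + t) * suc (12 * t) ≤ n → Σ[ c ∈ Fin 2 ] Σ[ W ∈ VSet ] Body W c t
        complete-body large = grow (t + t) (empty everything zero) (empty everything (suc zero)) z≤n z≤n refl
          (≤-trans large (≤-reflexive (sym (#-all (T? ∘ everything) _))))
          where
          everything : VSet
          everything = const true

-- Hooking all pairs of a completed body.

module Hooks where

  open Counting
  open Greedy
  open Bodies
  open import Data.Bool.Base using (T)
  open import Data.Unit.Polymorphic.Base using (⊤)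
  open import Data.Fin.Base as Fin using (Fin; zero; suc; combine; remQuot)
  open import Data.Fin.Properties using (any?; _≟_; remQuot-combine; combine-injective) renaming (_<?_ to _<ᶠ?_; <-cmp to <ᶠ-cmp)
  open import Data.Nat.Base
  open import Data.Nat.Properties hiding (_≟_)
  open import Data.Nat.Tactic.RingSolver using (solve-∀)
  open import Data.Product.Base using (Σ-syntax; ∃-syntax; _×_; _,_; proj₁; proj₂)
  open import Data.Sum.Base using (_⊎_; inj₁; inj₂)
  open import Function.Base using (_∘_)
  open import Function.Definitions using (Injective)
  open import Level using (0ℓ)
  open import Relation.Binary.Definitions using (tri<; tri≈; tri>)
  open import Relation.Binary.PropositionalEquality
  open import Relation.Nullary using (¬_; Dec; yes; no; contradiction; T?)
  open import Relation.Nullary.Decidable using (_×-dec_; ¬?; _→-dec_; ⊤-dec)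
  open import Relation.Unary using (Pred; Decidable)

  -- In a body the larger index `j` belongs to the older vertex, whose star serves the pair; hence
  -- `body j` is the first argument of `col`.
  record HedgehogIn {n : ℕ} (col : Fin n → Fin n → Fin n → Fin 2) (t : ℕ) : Set where
    field
      colour         : Fin 2
      body           : Fin t → Fin n
      body-injective : Injective _≡_ _≡_ body
      hook           : Fin t → Fin t → Fin n
      hook-colour    : ∀ {i j} → i Fin.< j → col (body j) (body i) (hook i j) ≡ colour
      hook∉body      : ∀ {i j} → i Fin.< j → ∀ k → hook i j ≢ body k
      hook-injective : ∀ {i j i′ j′} → i Fin.< j → i′ Fin.< j′ → hook i j ≡ hook i′ j′ → i ≡ i′ × j ≡ j′

  module HookAssignment
    {n : ℕ} (col : Fin n → Fin n → Fin n → Fin 2) (col-swap : ∀ u v w → col u v w ≡ col u w v) (t K N : ℕ)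
    where

    open BodyConstruction col col-swap t K

    module _
      {W : VSet} {c : Fin 2} (b : Body N W c t) (0<t : 0 < t) (t≤n : t ≤ n)
      (light-weight : weight c (Body.entry b) * 25 ≤ scale K) (16t²≤scale : 16 * (t * t) ≤ scale K)
      where

      open Body b

      u : Fin t → Fin n
      u i = vertex (entry i)

      -- The pairs that the star of the older vertex cannot serve; their hooks are sought among all
      -- vertices.
      Global : ∀ {m} → (Fin m → Entry) → Fin m → Fin m → Set
      Global es i j = i Fin.< j × Bad c (es j) (vertex (es i))

      global? : ∀ {m} (es : Fin m → Entry) i j → Dec (Global es i j)
      global? es i j = i <ᶠ? j ×-dec bad? c (es j) (vertex (es i))

      pair-wt : ∀ {m} → (Fin m → Entry) → Fin m → Fin m → ℕ
      pair-wt es i j = wt K (degree c (vertex (es j)) (vertex (es i)))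

      ∑-global≤weight : ∀ {m} (es : Fin m → Entry) →
        (sum λ i → sum λ j → indicator (global? es i j) * pair-wt es i j) ≤ weight c es
      ∑-global≤weight {zero}  es = z≤n
      ∑-global≤weight {suc m} es = +-mono-≤ newest (≤-trans (sum-mono older) (∑-global≤weight (es ∘ suc)))
        where
        newest : (sum λ j → indicator (global? es zero j) * pair-wt es zero j) ≤ sum λ j → ω c (es (suc j)) (vertex (es zero))
        newest = sum-mono λ j → *-monoˡ-≤ (pair-wt es zero (suc j))
          (indicator-mono (global? es zero (suc j)) (bad? c (es (suc j)) (vertex (es zero))) proj₂)
        older : ∀ i → (sum λ j → indicator (global? es (suc i) j) * pair-wt es (suc i) j) ≤
                      (sum λ j → indicator (global? (es ∘ suc) i j) * pair-wt (es ∘ suc) i j)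
        older i = sum-mono λ j → *-monoˡ-≤ (pair-wt es (suc i) (suc j))
          (indicator-mono (global? es (suc i) (suc j)) (global? (es ∘ suc) i j) λ (i<j , bad) → ≤-pred i<j , bad)

      -- Pairs are coded by a single number because the greedy assignment runs over one finite index
      -- type.
      fst snd : Fin (t * t) → Fin t
      fst x = proj₁ (remQuot {t} t x)
      snd x = proj₂ (remQuot {t} t x)

      Q : Pred (Fin (t * t)) 0ℓ
      Q x = Global entry (fst x) (snd x)

      Q? : Decidable Q
      Q? x = global? entry (fst x) (snd x)

      pairWeight : Fin (t * t) → ℕ
      pairWeight x = suc (pair-wt entry (fst x) (snd x))

      -- The units added to the weights contribute at most `t * t`, the weights themselves at most
      -- `weight c entry`. Nine times the sum is at most `9/16 + 9/25 = 369/400` of `scale K`.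
      ∑-pairWeight : (sum λ x → indicator (Q? x) * (pairWeight x * 9)) ≤ scale K
      ∑-pairWeight = begin
        (sum λ x → indicator (Q? x) * (pairWeight x * 9))
          ≡⟨ sum-combine t t _ ⟩
        (sum λ i → sum λ j → indicator (Q? (combine {t} {t} i j)) * (pairWeight (combine {t} {t} i j) * 9))
          ≡⟨ sum-cong-≗ (λ i → sum-cong-≗ λ j → cong
               (λ p → indicator (global? entry (proj₁ p) (proj₂ p)) * (suc (pair-wt entry (proj₁ p) (proj₂ p)) * 9))
               (remQuot-combine {t} i j)) ⟩
        (sum λ i → sum λ j → I i j * (suc (wtᵢⱼ i j) * 9))
          ≡⟨ sum-cong-≗ (λ i → sum-cong-≗ λ j → spread (I i j) (wtᵢⱼ i j)) ⟩
        (sum λ i → sum λ j → (I i j + I i j * wtᵢⱼ i j) * 9)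
          ≡⟨ sum-cong-≗ (λ i → *-distribʳ-sum 9 (λ j → I i j + I i j * wtᵢⱼ i j)) ⟨
        (sum λ i → (sum λ j → I i j + I i j * wtᵢⱼ i j) * 9)
          ≡⟨ *-distribʳ-sum 9 (λ i → sum λ j → I i j + I i j * wtᵢⱼ i j) ⟨
        (sum λ i → sum λ j → I i j + I i j * wtᵢⱼ i j) * 9
          ≡⟨ cong (_* 9) (sum-cong-≗ λ i → ∑-distrib-+ (I i) (λ j → I i j * wtᵢⱼ i j)) ⟩
        (sum λ i → sum (I i) + sum λ j → I i j * wtᵢⱼ i j) * 9
          ≡⟨ cong (_* 9) (∑-distrib-+ (λ i → sum (I i)) (λ i → sum λ j → I i j * wtᵢⱼ i j)) ⟩
        ((sum λ i → sum (I i)) + (sum λ i → sum λ j → I i j * wtᵢⱼ i j)) * 9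
          ≤⟨ *-monoˡ-≤ 9 (+-mono-≤ pairs≤t² (∑-global≤weight entry)) ⟩
        (t * t + weight c entry) * 9
          ≤⟨ bound (t * t) (weight c entry) (scale K) 16t²≤scale light-weight ⟩
        scale K ∎
        where
        open ≤-Reasoning
        I wtᵢⱼ : Fin t → Fin t → ℕ
        I i j = indicator (global? entry i j)
        wtᵢⱼ = pair-wt entry
        spread : ∀ a x → a * (suc x * 9) ≡ (a + a * x) * 9
        spread = solve-∀
        indicator≤1 : ∀ {A : Set} (a? : Dec A) → indicator a? ≤ 1
        indicator≤1 (yes _) = ≤-refl
        indicator≤1 (no _)  = z≤n
        pairs≤t² : (sum λ i → sum (I i)) ≤ t * t
        pairs≤t² = sum-replicate-≤ t t λ i → ≤-trans
          (sum-replicate-≤ t 1 λ j → indicator≤1 (global? entry i j)) (≤-reflexive (*-identityʳ t))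
        bound : ∀ a w M → 16 * a ≤ M → w * 25 ≤ M → (a + w) * 9 ≤ M
        bound a w M 16a≤M 25w≤M = *-cancelˡ-≤ 400 (begin
          400 * ((a + w) * 9)              ≡⟨ regroup a w ⟩
          225 * (16 * a) + 144 * (w * 25)  ≤⟨ +-mono-≤ (*-monoʳ-≤ 225 16a≤M) (*-monoʳ-≤ 144 25w≤M) ⟩
          225 * M + 144 * M                ≡⟨ *-distribʳ-+ M 225 144 ⟨
          369 * M                          ≤⟨ *-monoˡ-≤ M (m≤m+n 369 31) ⟩
          400 * M                          ∎)
          where
          regroup : ∀ a w → 400 * ((a + w) * 9) ≡ 225 * (16 * a) + 144 * (w * 25)
          regroup = solve-∀

      star-disjoint : ∀ {i j v} → T (star (entry i) v) → T (star (entry j) v) → i ≡ j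
      star-disjoint {i} {j} v∈i v∈j with <ᶠ-cmp i j
      ... | tri< i<j _ _  = contradiction v∈j (Compatible.disjoint (compatible i<j) v∈i)
      ... | tri≈ _ i≡j _  = i≡j
      ... | tri> _ _ j<i  = contradiction v∈i (Compatible.disjoint (compatible j<i) v∈j)

      star∌body : ∀ j k → ¬ T (star (entry j) (u k))
      star∌body j k with <ᶠ-cmp j k
      ... | tri< j<k _ _    = Compatible.old∉new (compatible j<k)
      ... | tri≈ _ refl _   = star∌self j
      ... | tri> _ _ k<j    = Compatible.new∉old (compatible k<j)

      u-injective : Injective _≡_ _≡_ u
      u-injective {i} {j} eq with <ᶠ-cmp i j
      ... | tri< i<j _ _  = contradiction eq (Compatible.distinct (compatible i<j))
      ... | tri≈ _ i≡j _  = i≡j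
      ... | tri> _ _ j<i  = contradiction (sym eq) (Compatible.distinct (compatible j<i))

      InBody : Pred (Fin n) 0ℓ
      InBody v = ∃[ k ] ⊤ {0ℓ} × u k ≡ v

      inBody? : Decidable InBody
      inBody? v = any? λ k → ⊤-dec ×-dec u k ≟ v

      #body≤t : # inBody? ≤ t
      #body≤t = ≤-trans (#-image (λ _ → ⊤-dec) u inBody?) (≤-reflexive (#-all {t} (λ _ → ⊤-dec) _))

      0<scale : 0 < scale K
      0<scale = ≤-trans 0<t (≤-trans (m≤m*n t t ⦃ >-nonZero 0<t ⦄) (≤-trans (m≤n*m (t * t) 16) 16t²≤scale))

      open GreedyAssignment t (scale K) 0<scale
        {N = λ x → Hook c (u (snd x)) (u (fst x))} (λ x → hook? c (u (snd x)) (u (fst x)))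
        {B = λ i v → T (star (entry i) v)} (λ i v → T? (star (entry i) v)) star-disjoint #star≤
        inBody? #body≤t pairWeight (u (Fin.fromℕ< 0<t))
        using (Assignment; assign; Used; used?)

      feasible : ∀ {x} → Q x → 4 * t ≤ degree c (u (snd x)) (u (fst x)) ×
                               scale K ≤ pairWeight x * degree c (u (snd x)) (u (fst x))
      feasible (i<j , bad) = ≤-trans (≤-reflexive (sym scale-0)) high , scale≤wt*d K high
        where high = Compatible.high-degree (compatible i<j) bad

      -- Star hooks chosen beside the hooks of the bad pairs.

      module _ (assignment : Assignment Q?) where
        open Assignment assignment

        Star : Fin t → Fin t → Set
        Star i j = i Fin.< j × ¬ Bad c (entry j) (u i)

        -- The condition is vacuous for pairs not served by a star, so that all `t` indices `i`
        -- enter one system of representatives for `j`; `t ≤ n` makes these unrestricted sets large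
        -- enough.
        Candidate : Fin t → Fin t → Pred (Fin n) 0ℓ
        Candidate j i v = Star i j → StarHook c (entry j) (u i) v × ¬ Used Q hook v

        candidate? : ∀ j i → Decidable (Candidate j i)
        candidate? j i v = (i <ᶠ? j ×-dec ¬? (bad? c (entry j) (u i))) →-dec
                           (starHook? c (entry j) (u i) v ×-dec ¬? (used? Q? hook v))

        #candidates : ∀ j i → t ≤ # (candidate? j i)
        #candidates j i with i <ᶠ? j ×-dec ¬? (bad? c (entry j) (u i))
        ... | no ¬s = ≤-trans t≤n (≤-reflexive (sym (#-all
                        (λ v → no ¬s →-dec (starHook? c (entry j) (u i) v ×-dec ¬? (used? Q? hook v)))
                        λ v s → contradiction s ¬s)))
        ... | yes (i<j , ¬bad) = +-cancelʳ-≤ t t _ (begin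
          t + t                            ≡⟨ double t ⟩
          2 * t                            ≤⟨ ≮⇒≥ ¬bad ⟩
          # (starHook? c (entry j) (u i))  ≤⟨ #-⊎ (starHook? c (entry j) (u i)) free? taken? split ⟩
          -- Hooks of bad pairs occupy at most `t` vertices of this star.
          # free? + # taken?               ≤⟨ +-monoʳ-≤ (# free?) (load≤t j) ⟩
          # free? + t                      ∎)
          where
          open ≤-Reasoning
          double : ∀ t → t + t ≡ 2 * t
          double = solve-∀
          free? : Decidable (Candidate j i)
          free? v = yes (i<j , ¬bad) →-dec (starHook? c (entry j) (u i) v ×-dec ¬? (used? Q? hook v))
          taken? : Decidable λ v → T (star (entry j) v) × Used Q hook v
          taken? v = T? (star (entry j) v) ×-dec used? Q? hook v
          split : ∀ {v} → StarHook c (entry j) (u i) v → Candidate j i v ⊎ (T (star (entry j) v) × Used Q hook v)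
          split {v} s with used? Q? hook v
          ... | yes used = inj₂ (proj₁ s , used)
          ... | no ¬used = inj₁ λ _ → s , ¬used

        representatives : ∀ j → Σ[ f ∈ (Fin t → Fin n) ] (∀ i → Candidate j i (f i)) × Injective _≡_ _≡_ f
        representatives j = system-of-distinct-representatives (candidate? j) (#candidates j)

        star-hook : Fin t → Fin t → Fin n
        star-hook i j = proj₁ (representatives j) i

        global-hook : Fin t → Fin t → Fin n
        global-hook i j = hook (combine i j)

        hook-of : Fin t → Fin t → Fin n
        hook-of i j with bad? c (entry j) (u i)
        ... | yes _ = global-hook i j
        ... | no _  = star-hook i j

        Q-combine : ∀ {i j} → Global entry i j → Q (combine i j)
        Q-combine {i} {j} g = subst (λ p → Global entry (proj₁ p) (proj₂ p)) (sym (remQuot-combine {t} i j)) g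

        global-Hook : ∀ {i j} → Global entry i j → Hook c (u j) (u i) (global-hook i j)
        global-Hook {i} {j} g = subst (λ p → Hook c (u (proj₂ p)) (u (proj₁ p)) (global-hook i j))
          (remQuot-combine {t} i j) (hook∈N (Q-combine g))

        star-Hook : ∀ {i j} → Star i j → StarHook c (entry j) (u i) (star-hook i j) × ¬ Used Q hook (star-hook i j)
        star-Hook {i} {j} s = proj₁ (proj₂ (representatives j)) i s

        global≢star : ∀ {i j i′ j′} → Global entry i j → Star i′ j′ → global-hook i j ≢ star-hook i′ j′
        global≢star g s eq = proj₂ (star-Hook s) (_ , Q-combine g , eq)

        hook-colour′ : ∀ {i j} → i Fin.< j → col (u j) (u i) (hook-of i j) ≡ c
        hook-colour′ {i} {j} i<j with bad? c (entry j) (u i)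
        ... | yes bad = proj₂ (proj₂ (global-Hook (i<j , bad)))
        ... | no ¬bad = proj₂ (proj₁ (star-Hook (i<j , ¬bad)))

        hook∉body′ : ∀ {i j} → i Fin.< j → ∀ k → hook-of i j ≢ u k
        hook∉body′ {i} {j} i<j k eq with bad? c (entry j) (u i)
        ... | yes bad = hook∉F (Q-combine (i<j , bad)) (k , _ , sym eq)
        ... | no ¬bad = star∌body j k (subst (T ∘ star (entry j)) eq (proj₁ (proj₁ (star-Hook (i<j , ¬bad)))))

        -- Two global hooks are told apart by the assignment, and a global hook from a star hook
        -- because candidates avoid used vertices. Equal star hooks lie in the same star by
        -- disjointness, where representatives are distinct.
        hook-injective′ : ∀ {i j i′ j′} → i Fin.< j → i′ Fin.< j′ → hook-of i j ≡ hook-of i′ j′ → i ≡ i′ × j ≡ j′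
        hook-injective′ {i} {j} {i′} {j′} i<j i′<j′ eq with bad? c (entry j) (u i) | bad? c (entry j′) (u i′)
        ... | yes bad | yes bad′ = combine-injective i j i′ j′ (injective (Q-combine (i<j , bad)) (Q-combine (i′<j′ , bad′)) eq)
        ... | yes bad | no ¬bad′ = contradiction eq (global≢star (i<j , bad) (i′<j′ , ¬bad′))
        ... | no ¬bad | yes bad′ = contradiction (sym eq) (global≢star (i′<j′ , bad′) (i<j , ¬bad))
        ... | no ¬bad | no ¬bad′ = same (star-disjoint (proj₁ (proj₁ (star-Hook (i<j , ¬bad))))
            (subst (T ∘ star (entry j′)) (sym eq) (proj₁ (proj₁ (star-Hook (i′<j′ , ¬bad′)))))) eq
          where
          same : j ≡ j′ → star-hook i j ≡ star-hook i′ j′ → i ≡ i′ × j ≡ j′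
          same refl eq = proj₂ (proj₂ (representatives j)) eq , refl

      hedgehog : HedgehogIn col t
      hedgehog = record
        { colour         = c
        ; body           = u
        ; body-injective = u-injective
        ; hook           = hook-of assignment
        ; hook-colour    = hook-colour′ assignment
        ; hook∉body      = hook∉body′ assignment
        ; hook-injective = hook-injective′ assignment
        }
        where
        assignment : Assignment Q?
        assignment = assign Q? feasible ∑-pairWeight

-- Choice of the parameters, unavoidability, and existence of the Ramsey number.

module Existence where

  open Counting
  open Bodies
  open Hooks
  open import Data.Bool.Base using (Bool; true; false)
  open import Data.Fin.Base as Fin using (Fin; zero; suc; finToFun; funToFin)
  open import Data.Fin.Properties using (any?; all?; _≟_; finToFun-funToFin) renaming (_<?_ to _<ᶠ?_; <-irrelevant to <ᶠ-irrelevant)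
  open import Data.Fin.Subset using (Subset; ⁅_⁆; _∪_; ∣_∣)
  open import Data.Fin.Subset.Properties using (∪-comm; ∪-assoc)
  open import Data.Nat.Base
  open import Data.Nat.Combinatorics using (_C_)
  open import Data.Nat.Properties hiding (_≟_)
  import Data.Nat.Properties as ℕ
  open import Data.Nat.Tactic.RingSolver using (solve-∀)
  open import Data.Product.Base using (Σ-syntax; ∃-syntax; _×_; _,_; proj₁)
  open import Data.Sum.Base using (_⊎_; inj₁; inj₂; [_,_]′)
  open import Data.Vec.Base using (lookup; tabulate)
  open import Data.Vec.Properties using (tabulate-cong; tabulate∘lookup)
  open import Defs using (Triple; triple; Colouring; MonochromaticHedgehog; Unavoidable; IsRamseyNumber; Vertex; Edge; edge; image; vertex-count)
  open import Function.Base using (_∘_)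
  open import Function.Bundles using (Inverse)
  open import Function.Definitions using (Injective)
  open import Relation.Binary.PropositionalEquality
  open import Relation.Nullary using (¬_; Dec; yes; no; contradiction)
  open import Relation.Nullary.Decidable using (_×-dec_; _→-dec_; ¬?; map′)

  module _ {n : ℕ} (col : Fin n → Fin n → Fin n → Fin 2) (col-swap : ∀ u v w → col u v w ≡ col u w v)
           {t : ℕ} (L : ℕ) (0<t : 0 < t) (t≤2^ : t ≤ 2 ^ suc L) (large : 100 * (t * t) * (L + 4) ≤ n) where

    private
      K N : ℕ
      -- With `t ≤ 2 ^ suc L` this makes `scale K`, that is `16 * t * 2 ^ suc L`, at least
      -- `16 * (t * t)`.
      K = L + 3
      N = 100 * (t * t) * K

    open BodyConstruction col col-swap t K using (scale; weight; Body; complete-body; VSet)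
    open ≤-Reasoning

    private
      t≤t² : t ≤ t * t
      t≤t² = m≤m*n t t ⦃ >-nonZero 0<t ⦄

      0<t² : 0 < t * t
      0<t² = ≤-trans 0<t t≤t²

      0<K : 0 < K
      0<K = ≤-trans (m≤m+n 1 2) (m≤n+m 3 L)

      t≤n : t ≤ n
      t≤n = ≤-trans t≤t² (≤-trans (m≤n*m (t * t) 100)
        (≤-trans (m≤m*n (100 * (t * t)) (L + 4) ⦃ >-nonZero (≤-trans (m≤m+n 1 3) (m≤n+m 4 L)) ⦄) large))

      -- The `t + t` steps lose at most `26 * (t * t)` vertices, covered by the `100 * (t * t)`
      -- gained from `L + 4` exceeding `K` by one.
      enough : N + (t + t) * suc (12 * t) ≤ n
      enough = begin
        N + (t + t) * suc (12 * t)         ≡⟨ cong (N +_) (expand t) ⟩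
        N + (24 * (t * t) + 2 * t)         ≤⟨ +-monoʳ-≤ N (+-monoʳ-≤ (24 * (t * t)) (*-monoʳ-≤ 2 t≤t²)) ⟩
        N + (24 * (t * t) + 2 * (t * t))   ≡⟨ cong (N +_) (*-distribʳ-+ (t * t) 24 2) ⟨
        N + 26 * (t * t)                   ≤⟨ +-monoʳ-≤ N (*-monoˡ-≤ (t * t) (m≤m+n 26 74)) ⟩
        N + 100 * (t * t)                  ≡⟨ collect (100 * (t * t)) L ⟩
        100 * (t * t) * (L + 4)            ≤⟨ large ⟩
        n                                  ∎
        where
        expand : ∀ t → (t + t) * suc (12 * t) ≡ 24 * (t * t) + 2 * t
        expand = solve-∀
        collect : ∀ a L → a * (L + 3) + a ≡ a * (L + 4)
        collect = solve-∀

      -- The factor `25` is the `100` in `N` divided by the `4` in the field `light`.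
      light-weight : ∀ w {M} → w * N ≤ t * (4 * t * K * M) → w * 25 ≤ M
      light-weight w {M} light = *-cancelˡ-≤ (4 * (t * t) * K) ⦃ 4t²K≢0 ⦄ (begin
        4 * (t * t) * K * (w * 25)  ≡⟨ regroup (t * t) K w ⟩
        w * N                       ≤⟨ light ⟩
        t * (4 * t * K * M)         ≡⟨ regroup′ t K M ⟩
        4 * (t * t) * K * M         ∎)
        where
        4t²K≢0 : NonZero (4 * (t * t) * K)
        4t²K≢0 = >-nonZero (*-mono-≤ {1} (≤-trans 0<t² (m≤n*m (t * t) 4)) 0<K)
        regroup : ∀ a K w → 4 * a * K * (w * 25) ≡ w * (100 * a * K)
        regroup = solve-∀
        regroup′ : ∀ t K x → t * (4 * t * K * x) ≡ 4 * (t * t) * K * x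
        regroup′ = solve-∀

      16t²≤scale : 16 * (t * t) ≤ scale K
      16t²≤scale = begin
        16 * (t * t)              ≤⟨ *-monoʳ-≤ 16 (*-monoʳ-≤ t t≤2^) ⟩
        16 * (t * 2 ^ suc L)      ≡⟨ regroup t (2 ^ suc L) ⟩
        4 * t * (2 ^ suc L * 4)   ≡⟨ cong (4 * t *_) (^-distribˡ-+-* 2 (suc L) 2) ⟨
        4 * t * 2 ^ (suc L + 2)   ≡⟨ cong (λ k → 4 * t * 2 ^ k) (+-suc L 2) ⟨
        scale K                   ∎
        where
        regroup : ∀ t p → 16 * (t * p) ≡ 4 * t * (p * 4)
        regroup = solve-∀

      from-body : Σ[ c ∈ Fin 2 ] Σ[ W ∈ VSet ] Body N W c t → HedgehogIn col t
      from-body (c , W , b) = HookAssignment.hedgehog col col-swap t K N b 0<t t≤n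
        (light-weight (weight c (BodyConstruction.Body.entry b)) (BodyConstruction.Body.light b)) 16t²≤scale

    hedgehogIn : HedgehogIn col t
    hedgehogIn = from-body (complete-body N 0<t (*-mono-≤ {1} (≤-trans 0<t² (m≤n*m (t * t) 100)) 0<K) enough)

  -- Passage between colourings of triples and functions of three vertices.

  triple-≡ : ∀ {n} {e e′ : Triple n} → proj₁ e ≡ proj₁ e′ → e ≡ e′
  triple-≡ {e = e , p} {e′ = .e , q} refl = cong (e ,_) (≡-irrelevant p q)

  module _ {n : ℕ} (χ : Colouring n) where

    Distinct : Fin n → Fin n → Fin n → Set
    Distinct u v w = u ≢ v × u ≢ w × v ≢ w

    distinct? : ∀ u v w → Dec (Distinct u v w)
    distinct? u v w = ¬? (u ≟ v) ×-dec ¬? (u ≟ w) ×-dec ¬? (v ≟ w)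

    -- The colour of a degenerate triple is junk.
    col : Fin n → Fin n → Fin n → Fin 2
    col u v w with distinct? u v w
    ... | yes (u≢v , u≢w , v≢w) = χ (triple u v w u≢v u≢w v≢w)
    ... | no _ = zero

    col-triple : ∀ {u v w} u≢v u≢w v≢w → col u v w ≡ χ (triple u v w u≢v u≢w v≢w)
    col-triple {u} {v} {w} u≢v u≢w v≢w with distinct? u v w
    ... | yes _ = cong χ (triple-≡ refl)
    ... | no ¬d = contradiction (u≢v , u≢w , v≢w) ¬d

    col-swap : ∀ u v w → col u v w ≡ col u w v
    col-swap u v w with distinct? u v w | distinct? u w v
    ... | yes _ | yes _ = cong χ (triple-≡ (cong (⁅ u ⁆ ∪_) (∪-comm ⁅ v ⁆ ⁅ w ⁆)))
    ... | yes (u≢v , u≢w , v≢w) | no ¬d = contradiction (u≢w , u≢v , v≢w ∘ sym) ¬d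
    ... | no ¬d | yes (u≢w , u≢v , w≢v) = contradiction (u≢v , u≢w , w≢v ∘ sym) ¬d
    ... | no _ | no _ = refl

    monochromatic : ∀ {t} → HedgehogIn col t → MonochromaticHedgehog t χ
    monochromatic {t} H = record { embed = embed ; injective = injective ; colour = colour ; mono = mono }
      where
      open HedgehogIn H
      embed : Vertex t → Fin n
      embed (inj₁ i)           = body i
      embed (inj₂ (i , j , _)) = hook i j
      injective : Injective _≡_ _≡_ embed
      injective {inj₁ i} {inj₁ j} eq = cong inj₁ (body-injective eq)
      injective {inj₁ i} {inj₂ (_ , _ , p)} eq = contradiction (sym eq) (hook∉body p i)
      injective {inj₂ (_ , _ , p)} {inj₁ j} eq = contradiction eq (hook∉body p j)
      injective {inj₂ (_ , _ , p)} {inj₂ (_ , _ , q)} eq with hook-injective p q eq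
      ... | refl , refl = cong (λ r → inj₂ (_ , _ , r)) (<ᶠ-irrelevant p q)
      mono : ∀ {u v w} (e : Edge t u v w) → χ (image embed injective e) ≡ colour
      mono (edge {i} {j} i<j) = trans
        -- An edge lists the smaller index first, whereas `hook-colour` puts the larger one first.
        (cong χ (triple-≡ (reorder ⁅ body i ⁆ ⁅ body j ⁆ ⁅ hook i j ⁆)))
        (trans (sym (col-triple j≢i (hook∉body i<j j ∘ sym) (hook∉body i<j i ∘ sym))) (hook-colour i<j))
        where
        j≢i : body j ≢ body i
        j≢i eq = <-irrefl (cong Fin.toℕ (sym (body-injective eq))) i<j
        reorder : ∀ (p q r : Subset n) → p ∪ (q ∪ r) ≡ q ∪ (p ∪ r)
        reorder p q r = trans (sym (∪-assoc p q r)) (trans (cong (_∪ r) (∪-comm p q)) (∪-assoc q p r))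

  unavoidable : ∀ {t n} L → 0 < t → t ≤ 2 ^ suc L → 100 * (t * t) * (L + 4) ≤ n → Unavoidable t n
  unavoidable L 0<t t≤2^ large χ = monochromatic χ (hedgehogIn (col χ) (col-swap χ) L 0<t t≤2^ large)

  -- Decidability of unavoidability and the least unavoidable number.

  module _ {t n : ℕ} where

    image-cong : ∀ {f g : Vertex t → Fin n} → f ≗ g → (f-inj : Injective _≡_ _≡_ f) (g-inj : Injective _≡_ _≡_ g) →
                 ∀ {u v w} (e : Edge t u v w) →
                 image f f-inj e ≡ image g g-inj e
    image-cong f≗g f-inj g-inj {u} {v} {w} e =
      triple-≡ (cong₂ _∪_ (cong ⁅_⁆ (f≗g u)) (cong₂ _∪_ (cong ⁅_⁆ (f≗g v)) (cong ⁅_⁆ (f≗g w))))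

    -- Quantification over indices instead of `Edge` lets the condition be decided by a search over
    -- `Fin t`.
    Mono : Colouring n → (Vertex t → Fin n) → Fin 2 → Set
    Mono χ f c = Σ[ inj ∈ Injective _≡_ _≡_ f ] (∀ i j (i<j : i Fin.< j) → χ (image f inj (edge i<j)) ≡ c)

    -- The enumeration reaches an embedding only up to pointwise equality; this is enough because
    -- the image of an edge depends on values alone.
    Mono-cong : ∀ {χ f g c} → f ≗ g → Mono χ f c → Mono χ g c
    Mono-cong {χ} {f} {g} f≗g (inj , mono) =
      g-inj , λ i j i<j → trans (cong χ (image-cong (sym ∘ f≗g) g-inj inj (edge i<j))) (mono i j i<j)
      where
      g-inj : Injective _≡_ _≡_ g
      g-inj {x} {y} eq = inj (trans (f≗g x) (trans eq (sym (f≗g y))))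

    private
      N : ℕ
      N = t + t C 2
      to : Fin N → Vertex t
      to = Inverse.to (vertex-count t)
      from : Vertex t → Fin N
      from = Inverse.from (vertex-count t)
      to-from : ∀ v → to (from v) ≡ v
      to-from v = Inverse.inverseˡ (vertex-count t) refl
      from-to : ∀ k → from (to k) ≡ k
      from-to k = Inverse.inverseʳ (vertex-count t) refl

    injective? : ∀ (f : Vertex t → Fin n) → Dec (Injective _≡_ _≡_ f)
    injective? f = map′ up down (all? λ k → all? λ l → (f (to k) ≟ f (to l)) →-dec (k ≟ l))
      where
      up : (∀ k l → f (to k) ≡ f (to l) → k ≡ l) → Injective _≡_ _≡_ f
      up inj {x} {y} eq = trans (sym (to-from x)) (trans (cong to (inj (from x) (from y)
        (trans (cong f (to-from x)) (trans eq (cong f (sym (to-from y))))))) (to-from y))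
      down : Injective _≡_ _≡_ f → ∀ k l → f (to k) ≡ f (to l) → k ≡ l
      down inj k l eq = trans (sym (from-to k)) (trans (cong from (inj eq)) (from-to l))

    Mono? : ∀ χ f c → Dec (Mono χ f c)
    Mono? χ f c with injective? f
    ... | no ¬inj = no (¬inj ∘ proj₁)
    ... | yes inj = map′ (inj ,_)
      (λ (inj′ , mono) i j i<j → trans (cong χ (image-cong (λ _ → refl) inj inj′ (edge i<j))) (mono i j i<j))
      (all? λ i → all? λ j → edge? i j)
      where
      edge? : ∀ i j → Dec (∀ (i<j : i Fin.< j) → χ (image f inj (edge i<j)) ≡ c)
      edge? i j with i <ᶠ? j
      ... | no i≮j  = yes λ i<j → contradiction i<j i≮j
      ... | yes i<j = map′ (λ eq p → subst (λ p → χ (image f inj (edge p)) ≡ c) (<ᶠ-irrelevant i<j p) eq)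
                           (λ eq → eq i<j) (χ (image f inj (edge i<j)) ≟ c)

    monochromaticHedgehog? : ∀ χ → Dec (MonochromaticHedgehog t χ)
    monochromaticHedgehog? χ = map′ up down (any? λ k → any? λ c → Mono? χ (finToFun {n} {N} k ∘ from) c)
      where
      up : ∃[ k ] ∃[ c ] Mono χ (finToFun {n} {N} k ∘ from) c → MonochromaticHedgehog t χ
      up (k , c , inj , mono) = record
        { embed = finToFun {n} {N} k ∘ from ; injective = inj ; colour = c ; mono = λ { (edge i<j) → mono _ _ i<j } }
      down : MonochromaticHedgehog t χ → ∃[ k ] ∃[ c ] Mono χ (finToFun {n} {N} k ∘ from) c
      down H = funToFin (embed ∘ to) , colour ,
        Mono-cong {χ} (λ v → trans (sym (cong embed (to-from v))) (sym (finToFun-funToFin (embed ∘ to) (from v))))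
          (injective , λ _ _ i<j → mono (edge i<j))
        where open MonochromaticHedgehog H

    MonochromaticHedgehog-cong : ∀ {χ χ′ : Colouring n} → χ ≗ χ′ →
                                 MonochromaticHedgehog t χ → MonochromaticHedgehog t χ′
    MonochromaticHedgehog-cong χ≗χ′ H = record
      { embed = embed ; injective = injective ; colour = colour ; mono = λ e → trans (sym (χ≗χ′ _)) (mono e) }
      where open MonochromaticHedgehog H

  module _ {n : ℕ} where

    private
      bit : Bool → Fin 2
      bit false = zero
      bit true  = suc zero

      unbit : Fin 2 → Bool
      unbit zero       = false
      unbit (suc zero) = true

      unbit-bit : ∀ b → unbit (bit b) ≡ b
      unbit-bit false = refl
      unbit-bit true  = refl

    encode : Subset n → Fin (2 ^ n)
    encode e = funToFin (bit ∘ lookup e)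

    decode : Fin (2 ^ n) → Subset n
    decode k = tabulate (unbit ∘ finToFun k)

    decode-encode : ∀ e → decode (encode e) ≡ e
    decode-encode e = trans
      (tabulate-cong λ i → trans (cong unbit (finToFun-funToFin (bit ∘ lookup e) i)) (unbit-bit (lookup e i)))
      (tabulate∘lookup e)

    colouring : Fin (2 ^ 2 ^ n) → Colouring n
    colouring k (e , _) = finToFun {2} {2 ^ n} k (encode e)

    -- Extended by `zero` to all subsets, `χ` becomes a function between finite types and is coded
    -- by a number; on triples the code gives `χ` back pointwise.
    colouring-surjective : ∀ (χ : Colouring n) → ∃[ k ] colouring k ≗ χ
    colouring-surjective χ = funToFin (total ∘ decode) , λ (e , p) →
      trans (finToFun-funToFin (total ∘ decode) (encode e)) (trans (cong total (decode-encode e)) (total-≡ e p))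
      where
      total : Subset n → Fin 2
      total e with ∣ e ∣ ℕ.≟ 3
      ... | yes p = χ (e , p)
      ... | no _  = zero
      total-≡ : ∀ e p → total e ≡ χ (e , p)
      total-≡ e p with ∣ e ∣ ℕ.≟ 3
      ... | yes _ = cong χ (triple-≡ refl)
      ... | no ¬p = contradiction p ¬p

  -- Only finitely many colourings have to be checked, so the least unavoidable `n` can be found
  -- constructively.
  unavoidable? : ∀ t n → Dec (Unavoidable t n)
  unavoidable? t n = map′ up (λ all k → all (colouring k)) (all? λ k → monochromaticHedgehog? {t} (colouring k))
    where
    up : (∀ k → MonochromaticHedgehog t (colouring k)) → Unavoidable t n
    up all χ = let (k , k≗χ) = colouring-surjective χ in MonochromaticHedgehog-cong k≗χ (all k)

  least : ∀ {P : ℕ → Set} → (∀ n → Dec (P n)) → ∀ n → P n → ∃[ r ] P r × (∀ m → P m → r ≤ m)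
  least {P} P? n p = [ (λ none → contradiction p (none n ≤-refl)) , (λ found → found) ]′ (search (suc n))
    where
    search : ∀ k → (∀ m → m < k → ¬ P m) ⊎ (∃[ r ] P r × (∀ m → P m → r ≤ m))
    search zero = inj₁ λ _ ()
    search (suc k) with search k
    ... | inj₂ found = inj₂ found
    ... | inj₁ none with P? k
    ...   | yes q = inj₂ (k , q , λ m pm → ≮⇒≥ λ m<k → none m m<k pm)
    ...   | no ¬q = inj₁ λ m m<1+k pm → [ (λ m<k → none m m<k pm) , (λ { refl → ¬q pm }) ]′ (m≤n⇒m<n∨m≡n (≤-pred m<1+k))

  ramseyNumber : ∀ {t n} → Unavoidable t n → ∃[ r ] IsRamseyNumber t r
  ramseyNumber {t} {n} = least (unavoidable? t) n

-- A lower bound for the logarithm by dyadic blocks.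

module Logarithm where

  open import Defs using (riemann; ∑<; 1/1+_; ln; seq; _·_; module RiemannSums)
  open RiemannSums using (frac; ∑-split; ∑-mono; ∑-const; frac-cancel; frac-suc; recip-anti; recip-nonneg; refine-≥)
  import Data.Integer.Base as ℤ
  open import Data.Nat.Base as ℕ using (ℕ; zero; suc; _^_; z≤n; s≤s)
  import Data.Nat.Properties as ℕₚ
  open import Data.Product.Base using (∃-syntax; _×_; _,_)
  open import Data.Rational.Base as ℚ using (ℚ; 0ℚ; 1ℚ; ½; _+_; _*_; _≤_)
  open import Data.Rational.Properties
  open import Relation.Binary.PropositionalEquality
  open import Relation.Nullary using (yes; no)
  open import Relation.Nullary.Decidable using (from-no)

  log₂-bounds : ∀ t → 1 ℕ.≤ t → ∃[ L ] 2 ^ L ℕ.≤ t × t ℕ.< 2 ^ suc L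
  log₂-bounds (suc zero)    _ = 0 , s≤s z≤n , s≤s (s≤s z≤n)
  log₂-bounds (suc (suc t)) _ with log₂-bounds (suc t) (s≤s z≤n)
  ... | L , 2^L≤ , <2^ with suc (suc t) ℕₚ.<? 2 ^ suc L
  ...   | yes lt = L , ℕₚ.m≤n⇒m≤1+n 2^L≤ , lt
  ...   | no ≮   = suc L , ℕₚ.≮⇒≥ ≮ , ℕₚ.≤-<-trans <2^ (ℕₚ.^-monoʳ-< 2 (s≤s (s≤s z≤n)) (ℕₚ.n<1+n (suc L)))

  ι : ℕ → ℚ
  ι n = ℤ.+ n ℚ./ 1

  ι-suc : ∀ n → ι (suc n) ≡ 1ℚ + ι n
  ι-suc n = trans (sym (frac-suc n 0)) (+-comm (ι n) 1ℚ)

  ι-+ : ∀ m n → ι (m ℕ.+ n) ≡ ι m + ι n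
  ι-+ zero    n = sym (+-identityˡ (ι n))
  ι-+ (suc m) n = begin
    ι (suc (m ℕ.+ n))    ≡⟨ ι-suc (m ℕ.+ n) ⟩
    1ℚ + ι (m ℕ.+ n)     ≡⟨ cong (1ℚ +_) (ι-+ m n) ⟩
    1ℚ + (ι m + ι n)     ≡⟨ +-assoc 1ℚ (ι m) (ι n) ⟨
    1ℚ + ι m + ι n       ≡⟨ cong (_+ ι n) (ι-suc m) ⟨
    ι (suc m) + ι n      ∎
    where open ≡-Reasoning

  ι-nonneg : ∀ n → 0ℚ ≤ ι n
  ι-nonneg zero    = ≤-refl
  ι-nonneg (suc n) = ≤-trans (+-mono-≤ (recip-nonneg 0) (ι-nonneg n)) (≤-reflexive (sym (ι-suc n)))

  ι-mono : ∀ {m n} → m ℕ.≤ n → ι m ≤ ι n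
  ι-mono {m} {n} m≤n = begin
    ι m                  ≡⟨ +-identityʳ (ι m) ⟨
    ι m + 0ℚ             ≤⟨ +-monoʳ-≤ (ι m) (ι-nonneg (n ℕ.∸ m)) ⟩
    ι m + ι (n ℕ.∸ m)    ≡⟨ ι-+ m (n ℕ.∸ m) ⟨
    ι (m ℕ.+ (n ℕ.∸ m))  ≡⟨ cong ι (ℕₚ.m+[n∸m]≡n m≤n) ⟩
    ι n                  ∎
    where open ≤-Reasoning

  -- Distinct naturals are at least `1` apart: `n < m` would give `ι n + 1ℚ ≤ ι n + ½`. Hence an
  -- error of `½` does no harm in comparisons of naturals.
  ι-cancel-½ : ∀ {m n} → ι m ≤ ι n + ½ → m ℕ.≤ n
  ι-cancel-½ {m} {n} m≤n+½ = ℕₚ.≮⇒≥ λ n<m → from-no (1ℚ ≤? ½) (+-cancelˡ-≤ (begin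
    ι n + 1ℚ     ≡⟨ +-comm (ι n) 1ℚ ⟩
    1ℚ + ι n     ≡⟨ ι-suc n ⟨
    ι (suc n)    ≤⟨ ι-mono n<m ⟩
    ι m          ≤⟨ m≤n+½ ⟩
    ι n + ½      ∎))
    where
    open ≤-Reasoning
    +-cancelˡ-≤ : ι n + 1ℚ ≤ ι n + ½ → 1ℚ ≤ ½
    +-cancelˡ-≤ le = ≮⇒≥ λ ½<1 → <-irrefl refl (<-≤-trans (+-monoʳ-< (ι n) ½<1) le)

  seq-· : ∀ c x n → seq (c · x) n ≡ ι c * seq x n
  seq-· zero    x n = sym (*-zeroˡ (seq x n))
  seq-· (suc c) x n = begin
    seq x n + seq (c · x) n          ≡⟨ cong₂ _+_ (sym (*-identityˡ (seq x n))) (seq-· c x n) ⟩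
    1ℚ * seq x n + ι c * seq x n     ≡⟨ *-distribʳ-+ (seq x n) 1ℚ (ι c) ⟨
    (1ℚ + ι c) * seq x n             ≡⟨ cong (_* seq x n) (ι-suc c) ⟨
    ι (suc c) * seq x n              ∎
    where open ≡-Reasoning

  ι-* : ∀ m n → ι (m ℕ.* n) ≡ ι m * ι n
  ι-* zero    n = sym (*-zeroˡ (ι n))
  ι-* (suc m) n = begin
    ι (n ℕ.+ m ℕ.* n)      ≡⟨ ι-+ n (m ℕ.* n) ⟩
    ι n + ι (m ℕ.* n)      ≡⟨ cong₂ _+_ (sym (*-identityˡ (ι n))) (ι-* m n) ⟩
    1ℚ * ι n + ι m * ι n   ≡⟨ *-distribʳ-+ (ι n) 1ℚ (ι m) ⟨
    (1ℚ + ι m) * ι n       ≡⟨ cong (_* ι n) (ι-suc m) ⟨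
    ι (suc m) * ι n        ∎
    where open ≡-Reasoning

  -- The summands run from `1/2` to `1/2^L`. The next block, up to `1/2^(L+1)`, has `2^L` terms,
  -- none below its last, and so adds at least `½`.
  harmonic-dyadic : ∀ L → ι L * ½ ≤ ∑< (2 ^ L ℕ.∸ 1) (λ i → 1/1+ (1 ℕ.+ i))
  harmonic-dyadic zero    = ≤-reflexive (*-zeroˡ ½)
  harmonic-dyadic (suc L) = begin
    ι (suc L) * ½
      ≡⟨ cong (_* ½) (ι-suc L) ⟩
    (1ℚ + ι L) * ½
      ≡⟨ *-distribʳ-+ ½ 1ℚ (ι L) ⟩
    1ℚ * ½ + ι L * ½
      ≡⟨ +-comm (1ℚ * ½) (ι L * ½) ⟩
    ι L * ½ + ½
      ≤⟨ +-mono-≤ (harmonic-dyadic L) block ⟩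
    ∑< a f + ∑< (2 ^ L) (λ i → f (a ℕ.+ i))
      ≡⟨ ∑-split a (2 ^ L) f ⟨
    ∑< (a ℕ.+ 2 ^ L) f
      ≡⟨ cong (λ k → ∑< k f) (sym last) ⟩
    ∑< (2 ^ suc L ℕ.∸ 1) f ∎
    where
    open ≤-Reasoning
    a b : ℕ
    a = 2 ^ L ℕ.∸ 1
    b = 2 ^ suc L ℕ.∸ 1
    f : ℕ → ℚ
    f i = 1/1+ (1 ℕ.+ i)
    last : b ≡ a ℕ.+ 2 ^ L
    last = trans (cong (λ k → 2 ^ L ℕ.+ k ℕ.∸ 1) (ℕₚ.+-identityʳ (2 ^ L)))
                 (ℕₚ.+-∸-comm (2 ^ L) (ℕₚ.m^n>0 2 L))
    1+a+i≤b : ∀ {i} → i ℕ.< 2 ^ L → 1 ℕ.+ (a ℕ.+ i) ℕ.≤ b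
    1+a+i≤b {i} i< = ℕₚ.≤-trans (ℕₚ.≤-reflexive (sym (ℕₚ.+-suc a i)))
      (ℕₚ.≤-trans (ℕₚ.+-monoʳ-≤ a i<) (ℕₚ.≤-reflexive (sym last)))
    block : ½ ≤ ∑< (2 ^ L) (λ i → f (a ℕ.+ i))
    block = begin
      ½                                ≡⟨ frac-cancel (2 ^ L) 1 b (ℕₚ.m+[n∸m]≡n (ℕₚ.m^n>0 2 (suc L))) ⟨
      frac (2 ^ L) b                   ≡⟨ ∑-const (2 ^ L) b ⟨
      ∑< (2 ^ L) (λ i → 1/1+ b)        ≤⟨ ∑-mono (2 ^ L) (λ i i< → recip-anti (1+a+i≤b i<)) ⟩
      ∑< (2 ^ L) (λ i → f (a ℕ.+ i))   ∎

  -- Right Riemann sums of the decreasing function `1/x` do not decrease under refinement, so the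
  -- sum over unit intervals, `1/2 + ⋯ + 1/t`, is below every approximant; it contains the dyadic
  -- sum up to `1/2^L`.
  ln-dyadic : ∀ {t L} k → 2 ^ L ℕ.≤ t → ι L * ½ ≤ seq (ln t) k
  ln-dyadic {t} {L} k 2^L≤t = begin
    ι L * ½                         ≤⟨ harmonic-dyadic L ⟩
    ∑< a f                          ≡⟨ +-identityʳ (∑< a f) ⟨
    ∑< a f + 0ℚ                     ≤⟨ +-monoʳ-≤ (∑< a f) (nonneg (t ℕ.∸ 1 ℕ.∸ a)) ⟩
    ∑< a f + ∑< (t ℕ.∸ 1 ℕ.∸ a) (λ i → f (a ℕ.+ i))             ≡⟨ ∑-split a (t ℕ.∸ 1 ℕ.∸ a) f ⟨
    ∑< (a ℕ.+ (t ℕ.∸ 1 ℕ.∸ a)) f    ≡⟨ cong (λ k → ∑< k f) (ℕₚ.m+[n∸m]≡n (ℕₚ.∸-monoˡ-≤ 1 2^L≤t)) ⟩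
    ∑< (t ℕ.∸ 1) f                  ≡⟨ cong (λ k → ∑< k f) (ℕₚ.+-identityʳ (t ℕ.∸ 1)) ⟨
    riemann t 1                     ≤⟨ refine-≥ t 0 k ⟩
    riemann t (1 ℕ.* suc k)         ≡⟨ cong (riemann t) (ℕₚ.*-identityˡ (suc k)) ⟩
    riemann t (suc k)               ∎
    where
    open ≤-Reasoning
    a : ℕ
    a = 2 ^ L ℕ.∸ 1
    f : ℕ → ℚ
    f i = 1/1+ (1 ℕ.+ i)
    nonneg : ∀ m → 0ℚ ≤ ∑< m (λ i → f (a ℕ.+ i))
    nonneg zero    = ≤-refl
    nonneg (suc m) = +-mono-≤ (nonneg m) (recip-nonneg (1 ℕ.+ (a ℕ.+ m)))

  -- This is `L ≤ 2 ln t` multiplied by `c`, valid for every approximant; it turns the constant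
  -- `100` for `log₂ t` into `200` for `ln t`.
  ln-multiple : ∀ {t L} c k → 2 ^ L ℕ.≤ t → ι (c ℕ.* L) ≤ seq ((2 ℕ.* c) · ln t) k
  ln-multiple {t} {L} c k 2^L≤t = begin
    ι (c ℕ.* L)                     ≡⟨ ι-* c L ⟩
    ι c * ι L                       ≡⟨ cong (_* ι L) (trans (*-assoc (ι c) (ι 2) ½) (*-identityʳ (ι c))) ⟨
    ι c * ι 2 * ½ * ι L             ≡⟨ *-assoc (ι c * ι 2) ½ (ι L) ⟩
    ι c * ι 2 * (½ * ι L)           ≡⟨ cong₂ _*_ (trans (*-comm (ι c) (ι 2)) (sym (ι-* 2 c))) (*-comm ½ (ι L)) ⟩
    ι (2 ℕ.* c) * (ι L * ½)         ≤⟨ *-monoˡ-≤-nonNeg (ι (2 ℕ.* c)) ⦃ ℚ.nonNegative (ι-nonneg (2 ℕ.* c)) ⦄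
                                         (ln-dyadic {t} {L} k 2^L≤t) ⟩
    ι (2 ℕ.* c) * seq (ln t) k      ≡⟨ seq-· (2 ℕ.* c) (ln t) k ⟨
    seq ((2 ℕ.* c) · ln t) k        ∎
    where open ≤-Reasoning

-- Comparison of the integer threshold with the real one, and the theorem.

open Existence using (unavoidable; ramseyNumber)
open Logarithm using (ι; ι-+; ι-cancel-½; ln-multiple; log₂-bounds)
open import Defs
open import Data.Nat as ℕ using (ℕ)
import Data.Nat.Properties as ℕₚ
open import Data.Nat.Tactic.RingSolver using (solve-∀)
open import Data.Product using (_×_; ∃-syntax; _,_; proj₁; proj₂)
import Data.Rational as ℚ
import Data.Rational.Properties as ℚₚ
open import Relation.Binary.PropositionalEquality using (_≡_; refl; sym; trans; cong; subst)
open import Relation.Nullary.Decidable using (from-yes)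

≤-eventually : ∀ {x m} → x ≤ fromℕ m → ∃[ k ] seq x k ℚ.≤ ι m ℚ.+ ℚ.½
≤-eventually x≤m = let (k , bound) = x≤m ℚ.½ (from-yes (ℚ.0ℚ ℚ.<? ℚ.½)) in k , bound k ℕₚ.≤-refl

threshold : ∀ t L → 100 ℕ.* (t ℕ.* t) ℕ.* (L ℕ.+ 4) ≡ 100 ℕ.* t ℕ.^ 2 ℕ.* L ℕ.+ 400 ℕ.* t ℕ.^ 2
threshold t L = trans (arith (t ℕ.* t) L)
  -- `t ^ 2` unfolds to `t * (t * 1)`.
  (cong (λ x → 100 ℕ.* (t ℕ.* x) ℕ.* L ℕ.+ 400 ℕ.* (t ℕ.* x)) (sym (ℕₚ.*-identityʳ t)))
  where
  arith : ∀ a L → 100 ℕ.* a ℕ.* (L ℕ.+ 4) ≡ 100 ℕ.* a ℕ.* L ℕ.+ 400 ℕ.* a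
  arith = solve-∀

module _ (t L : ℕ) (2^L≤t : 2 ℕ.^ L ℕ.≤ t) where

  bound : ∀ k → ι (100 ℕ.* t ℕ.^ 2 ℕ.* L ℕ.+ 400 ℕ.* t ℕ.^ 2) ℚ.≤
                seq ((200 ℕ.* t ℕ.^ 2) · ln t + fromℕ (400 ℕ.* t ℕ.^ 2)) k
  bound k = begin
    ι (100 ℕ.* t ℕ.^ 2 ℕ.* L ℕ.+ 400 ℕ.* t ℕ.^ 2)
      ≡⟨ ι-+ (100 ℕ.* t ℕ.^ 2 ℕ.* L) (400 ℕ.* t ℕ.^ 2) ⟩
    ι (100 ℕ.* t ℕ.^ 2 ℕ.* L) ℚ.+ ι (400 ℕ.* t ℕ.^ 2)
      ≤⟨ ℚₚ.+-monoˡ-≤ (ι (400 ℕ.* t ℕ.^ 2)) (ln-multiple {t} {L} (100 ℕ.* t ℕ.^ 2) k 2^L≤t) ⟩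
    seq ((2 ℕ.* (100 ℕ.* t ℕ.^ 2)) · ln t) k ℚ.+ ι (400 ℕ.* t ℕ.^ 2)
      ≡⟨ cong (λ c → seq (c · ln t) k ℚ.+ ι (400 ℕ.* t ℕ.^ 2)) (sym (ℕₚ.*-assoc 2 100 (t ℕ.^ 2))) ⟩
    seq ((200 ℕ.* t ℕ.^ 2) · ln t) k ℚ.+ ι (400 ℕ.* t ℕ.^ 2) ∎
    where open ℚₚ.≤-Reasoning

  -- One approximant with error `½` suffices, since both sides of the conclusion are naturals.
  large : ∀ {n} → (200 ℕ.* t ℕ.^ 2) · ln t + fromℕ (400 ℕ.* t ℕ.^ 2) ≤ fromℕ n →
          100 ℕ.* (t ℕ.* t) ℕ.* (L ℕ.+ 4) ℕ.≤ n
  large {n} X≤n =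
    let (k , le) = ≤-eventually {(200 ℕ.* t ℕ.^ 2) · ln t + fromℕ (400 ℕ.* t ℕ.^ 2)} {n} X≤n
    in subst (ℕ._≤ n) (sym (threshold t L)) (ι-cancel-½ (ℚₚ.≤-trans (bound k) le))

  -- The additional summand `1` becomes strictness of the inequality between naturals.
  large-suc : ∀ {n} → (200 ℕ.* t ℕ.^ 2) · ln t + fromℕ (400 ℕ.* t ℕ.^ 2) + fromℕ 1 ≤ fromℕ n →
              100 ℕ.* (t ℕ.* t) ℕ.* (L ℕ.+ 4) ℕ.< n
  large-suc {n} X+1≤n =
    let (k , le) = ≤-eventually {(200 ℕ.* t ℕ.^ 2) · ln t + fromℕ (400 ℕ.* t ℕ.^ 2) + fromℕ 1} {n} X+1≤n
    in subst (ℕ._≤ n) (trans (ℕₚ.+-comm T 1) (cong ℕ.suc (sym (threshold t L)))) (ι-cancel-½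
         (ℚₚ.≤-trans (ℚₚ.≤-reflexive (ι-+ T 1)) (ℚₚ.≤-trans (ℚₚ.+-monoˡ-≤ (ι 1) (bound k)) le)))
    where
    T : ℕ
    T = 100 ℕ.* t ℕ.^ 2 ℕ.* L ℕ.+ 400 ℕ.* t ℕ.^ 2

theorem1p2 : ∀ (t : ℕ) → 10 ℕ.≤ t →
    (∀ (n : ℕ) → (200 ℕ.* t ℕ.^ 2) · ln t + fromℕ (400 ℕ.* t ℕ.^ 2) ≤ fromℕ n → Unavoidable t n)
    × (∃[ r ] IsRamseyNumber t r
    × fromℕ r < (200 ℕ.* t ℕ.^ 2) · ln t + fromℕ (400 ℕ.* t ℕ.^ 2) + fromℕ 1)
theorem1p2 t 10≤t = (λ n X≤n → unavoidable-from (large t L 2^L≤t X≤n)) , r , isRamsey ,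
  -- The integer threshold is itself unavoidable, so it is at least `r` by minimality, whereas
  -- `X+1≤r` would put it strictly below `r`.
  λ X+1≤r → ℕₚ.<-irrefl refl
    (ℕₚ.<-≤-trans (large-suc t L 2^L≤t X+1≤r) (proj₂ isRamsey _ (unavoidable-from ℕₚ.≤-refl)))
  where
  0<t : 0 ℕ.< t
  0<t = ℕₚ.≤-trans (ℕ.s≤s ℕ.z≤n) 10≤t
  L : ℕ
  L = proj₁ (log₂-bounds t 0<t)
  2^L≤t : 2 ℕ.^ L ℕ.≤ t
  2^L≤t = proj₁ (proj₂ (log₂-bounds t 0<t))
  unavoidable-from : ∀ {n} → 100 ℕ.* (t ℕ.* t) ℕ.* (L ℕ.+ 4) ℕ.≤ n → Unavoidable t n
  unavoidable-from = unavoidable L 0<t (ℕₚ.<⇒≤ (proj₂ (proj₂ (log₂-bounds t 0<t))))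
  ramsey : ∃[ r ] IsRamseyNumber t r
  ramsey = ramseyNumber (unavoidable-from ℕₚ.≤-refl)
  r : ℕ
  r = proj₁ ramsey
  isRamsey : IsRamseyNumber t r
  isRamsey = proj₂ ramsey
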